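{- Let $\pi\in\mathfrak{S}_n$, let $\Pi$ be the valley-hopping orbit of $\pi$, $\hat\Pi$ the restricted valley-hopping orbit of $\pi$, $\Pi'$ the cyclic valley-hopping orbit of $\Phi(\pi)$, and $\hat\Pi'$ the restricted cyclic valley-hopping orbit of $\Phi(\pi)$. Then (a) $\Phi(\Pi)=\Pi'$ and (b) $\Phi(\hat\Pi)=\hat\Pi'$.
   Context: Permutations $\pi=\pi_1\cdots\pi_n\in\mathfrak{S}_n$ are written in one-line notation, with convention $\pi_0=\pi_{n+1}=\infty$. A letter $\pi_i$ is a descent if $\pi_i>\pi_{i+1}$, an ascent if $\pi_i<\pi_{i+1}$; a peak if $\pi_{i-1}<\pi_i>\pi_{i+1}$, a valley if $\pi_{i-1}>\pi_i<\pi_{i+1}$, a double ascent if $\pi_{i-1}<\pi_i<\pi_{i+1}$, a double descent if $\pi_{i-1}>\pi_i>\pi_{i+1}$. Rix-factorization: $\pi=\alpha_1\cdots\alpha_k\beta$ is obtained by: (1) $w:=\pi$, $i:=0$; (2) if $w$ is increasing, $\beta:=w$, stop; else $i:=i+1$, let $x$ be the largest descent of the word $w$, write $w=w'xw''$; (3) if $w'$ is empty, $\beta:=w$, stop; else $\alpha_i:=w'x$, $w:=w''$, go to (2). $\beta_1(\pi)$ is the first letter of $\beta$. A rixed point of $\pi$ is a letter of the maximal increasing suffix of $\pi$ not smaller than $\beta_1(\pi)$; $\mathrm{Rix}(\pi)$ is their set (it is the set of letters of a suffix $\pi_j\cdots\pi_n$ of $\pi$, contained in $\beta$). Lin–Zeng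 bijection $\Phi:\mathfrak{S}_n\to\mathfrak{S}_n$: with $\mathrm{Rix}(\pi)=\{\pi_j,\dots,\pi_n\}$, let $\delta$ be defined by $\beta=\delta\pi_j\cdots\pi_n$. If $\delta=d_1\cdots d_l$ is nonempty let $\tilde\delta=(d_1,d_l,d_{l-1},\dots,d_2)$ (a cycle; absent if $\delta$ empty); for $\alpha_i=a_1\cdots a_l$ let $\tilde\alpha_i=(a_l,a_{l-1},\dots,a_1)$. Then $\Phi(\pi)=\tilde\alpha_1\cdots\tilde\alpha_k\tilde\delta(\pi_j)(\pi_{j+1})\cdots(\pi_n)$ in cycle notation. Valley-hopping: for $x\in[n]$ write $\pi=w_1w_2xw_4w_5$ with $w_2$ (resp. $w_4$) the maximal consecutive subword immediately left (resp. right) of $x$ with all letters smaller than $x$; $\varphi_x(\pi)=w_1w_4xw_2w_5$ if $x$ is a double ascent or double descent, $\varphi_x(\pi)=\pi$ if $x$ is a peak or valley. These commute; $\varphi_S=\prod_{x\in S}\varphi_x$; the valley-hopping orbit of $\pi$ is $\{\varphi_S(\pi):S\subseteq[n]\}$. Canonical cycle representation: each cycle is written with its largest element first, cycles listed in increasing order of largest elements. Foata's fundamental transformation $o:\mathfrak{S}_n\to\mathfrak{S}_n$ writes $\pi$ in canonical cycle representation and erases the parentheses, reading the result as a one-line permutation. $\psi_x=o^{ -1}\circ\varphi_x\circ o$, $\psi_S=\prod_{x\in S}\psi_x$; the cyclic valley-hopping orbit of $\tau$ is $\{\psi_S(\tau):S\subseteq[n]\}$. Restricted versions: $\hat\varphi_x(\pi)=\pi$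 if $x\in\mathrm{Rix}(\pi)$ or $x=\beta_1(\pi)$, and $\hat\varphi_x(\pi)=\varphi_x(\pi)$ otherwise; $\hat\varphi_S=\prod_{x\in S}\hat\varphi_x$, and the restricted valley-hopping orbit of $\pi$ is $\{\hat\varphi_S(\pi):S\subseteq[n]\}$. $\hat\psi_x(\tau)=\tau$ if $x$ is a fixed point of $\tau$ or $x$ is the first letter of $o(\tau)$, and $\hat\psi_x(\tau)=\psi_x(\tau)$ otherwise; $\hat\psi_S=\prod_{x\in S}\hat\psi_x$, and the restricted cyclic valley-hopping orbit of $\tau$ is $\{\hat\psi_S(\tau):S\subseteq[n]\}$. -}

module Defs where

open import Data.Nat using (ℕ; zero; suc; _∸_; _⊔_; _<?_; _≟_)
open import Data.Bool using (Bool; true; false; if_then_else_; _∧_; _∨_; not)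
open import Data.List using (List; []; _∷_; _++_; reverse; length; map; upTo; concat; foldr; take; takeWhileᵇ; dropWhileᵇ; filterᵇ)
open import Data.Bool.ListAction using (any)
open import Data.Maybe using (Maybe; just; nothing; fromMaybe)
open import Data.Product using (_×_; _,_; ∃; proj₁; proj₂)
open import Data.Vec using (Vec) renaming ([] to []ᵛ; _∷_ to _∷ᵛ_)
open import Data.Fin.Subset using (Subset)
open import Relation.Nullary using (does)
open import Relation.Binary.PropositionalEquality using (_≡_)
open import Data.List.Relation.Binary.Permutation.Propositional using (_↭_)

-- Basic helpers. Permutations of [n] = {1,…,n} are lists in one-line
-- notation (values 1..n).

_<ᵇ_ : ℕ → ℕ → Bool
m <ᵇ n = does (m <? n)

_==_ : ℕ → ℕ → Bool
m == n = does (m ≟ n)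

_==ᴹ_ : Maybe ℕ → ℕ → Bool
nothing ==ᴹ x = false
just a  ==ᴹ x = a == x

_∈ᵇ_ : ℕ → List ℕ → Bool
x ∈ᵇ w = any (_== x) w

range : ℕ → List ℕ
range n = map suc (upTo n)

IsPerm : ℕ → List ℕ → Set
IsPerm n w = w ↭ range n

head : List ℕ → Maybe ℕ
head []      = nothing
head (a ∷ _) = just a

last : List ℕ → Maybe ℕ
last []          = nothing
last (a ∷ [])    = just a
last (_ ∷ b ∷ w) = last (b ∷ w)

maxL : List ℕ → ℕ
maxL = foldr _⊔_ 0

breakAt : ℕ → List ℕ → Maybe (List ℕ × List ℕ)
breakAt x [] = nothing
breakAt x (y ∷ ys) with y == x
... | true  = just ([] , ys)
... | false with breakAt x ys
...   | nothing       = nothing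
...   | just (L , R)  = just (y ∷ L , R)

-- 1-based application of a permutation in one-line notation
at : List ℕ → ℕ → Maybe ℕ
at []      _             = nothing
at (a ∷ w) zero          = nothing
at (a ∷ w) (suc zero)    = just a
at (a ∷ w) (suc (suc k)) = at w (suc k)

app : List ℕ → ℕ → ℕ
app w x = fromMaybe x (at w x)

-- Cycle notation: a cycle (c₁ c₂ … c_k) maps c₁ ↦ c₂ ↦ … ↦ c_k ↦ c₁.

nextAux : ℕ → ℕ → List ℕ → Maybe ℕ
nextAux h x []          = nothing
nextAux h x (a ∷ [])    = if a == x then just h else nothing
nextAux h x (a ∷ b ∷ c) = if a == x then just b else nextAux h x (b ∷ c)

nextIn : ℕ → List ℕ → Maybe ℕ
nextIn x []      = nothing
nextIn x (h ∷ c) = nextAux h x (h ∷ c)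

imageCycles : List (List ℕ) → ℕ → ℕ
imageCycles [] x = x
imageCycles (c ∷ cs) x with nextIn x c
... | just y  = y
... | nothing = imageCycles cs x

fromCycles : ℕ → List (List ℕ) → List ℕ
fromCycles n cs = map (imageCycles cs) (range n)

-- Valley-hopping φ_x (letters outside the word: 0 = nothing, i.e. ∞)

-- boundary neighbour (nothing = ∞) is less than x
nbLess : Maybe ℕ → ℕ → Bool
nbLess nothing  x = false
nbLess (just a) x = a <ᵇ x

-- boundary neighbour (nothing = ∞) is greater than x
nbGreater : Maybe ℕ → ℕ → Bool
nbGreater nothing  x = true
nbGreater (just a) x = x <ᵇ a

hop : ℕ → List ℕ → List ℕ
hop x w with breakAt x w
... | nothing = w
... | just (L , R) =
  if doubleAsc ∨ doubleDesc then w1 ++ w4 ++ x ∷ w2 ++ w5 else w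
  where
  l = last L
  r = head R
  doubleAsc  = nbLess l x ∧ nbGreater r x
  doubleDesc = nbGreater l x ∧ nbLess r x
  w2 = reverse (takeWhileᵇ (_<ᵇ x) (reverse L))
  w1 = reverse (dropWhileᵇ (_<ᵇ x) (reverse L))
  w4 = takeWhileᵇ (_<ᵇ x) R
  w5 = dropWhileᵇ (_<ᵇ x) R

-- descents of a word (letters followed by a smaller letter; the last
-- letter is never a descent since it is followed by ∞)
descents : List ℕ → List ℕ
descents []          = []
descents (a ∷ [])    = []
descents (a ∷ b ∷ w) = if b <ᵇ a then a ∷ descents (b ∷ w) else descents (b ∷ w)

-- the algorithm with fuel (length π steps always suffice);
-- returns (α₁ … α_k , β)
rixAux : ℕ → List ℕ → List (List ℕ) × List ℕ
rixAux zero w = [] , w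
rixAux (suc k) w with descents w
... | [] = [] , w
... | d ∷ ds with breakAt (maxL (d ∷ ds)) w
...   | nothing = [] , w
...   | just ([] , R) = [] , w
...   | just (a ∷ L , R) =
          ((a ∷ L) ++ maxL (d ∷ ds) ∷ []) ∷ proj₁ (rixAux k R) , proj₂ (rixAux k R)

rixFact : List ℕ → List (List ℕ) × List ℕ
rixFact π = rixAux (length π) π

rixAlphas : List ℕ → List (List ℕ)
rixAlphas π = proj₁ (rixFact π)

rixBeta : List ℕ → List ℕ
rixBeta π = proj₂ (rixFact π)

-- β₁(π) (nothing only for the empty permutation)
beta1 : List ℕ → Maybe ℕ
beta1 π = head (rixBeta π)

incSuffixRev : List ℕ → List ℕ
incSuffixRev []          = []
incSuffixRev (a ∷ [])    = a ∷ []
incSuffixRev (a ∷ b ∷ w) = if b <ᵇ a then a ∷ incSuffixRev (b ∷ w) else a ∷ []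

maxIncSuffix : List ℕ → List ℕ
maxIncSuffix π = reverse (incSuffixRev (reverse π))

-- Rix(π), listed in the order of π (a suffix π_j ⋯ π_n)
rixPts : List ℕ → List ℕ
rixPts π with beta1 π
... | nothing = []
... | just b  = filterᵇ (λ y → not (y <ᵇ b)) (maxIncSuffix π)

deltaCyc : List ℕ → List (List ℕ)
deltaCyc []       = []
deltaCyc (d ∷ ds) = (d ∷ reverse ds) ∷ []

-- β = δ π_j ⋯ π_n
delta : List ℕ → List ℕ
delta π = take (length (rixBeta π) ∸ length (rixPts π)) (rixBeta π)

PhiCycles : List ℕ → List (List ℕ)
PhiCycles π = map reverse (rixAlphas π) ++ deltaCyc (delta π) ++ map (λ y → y ∷ []) (rixPts π)

Φ : List ℕ → List ℕ
Φ π = fromCycles (length π) (PhiCycles π)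

orbitAux : List ℕ → ℕ → ℕ → ℕ → List ℕ
orbitAux τ zero    s c = []
orbitAux τ (suc k) s c = if c == s then [] else c ∷ orbitAux τ k s (app τ c)

cycleOf : List ℕ → ℕ → List ℕ
cycleOf τ x = x ∷ orbitAux τ (length τ) x (app τ x)

-- canonical cycle representation: for m = 1,2,…,n, the cycle whose
-- largest element is m, written starting at m; then erase parentheses
foata : List ℕ → List ℕ
foata τ = concat (map (λ m → if maxL (cycleOf τ m) == m then cycleOf τ m else [])
                      (range (length τ)))

-- o⁻¹: cut a word before each left-to-right maximum, read the pieces as cycles
lrCut : ℕ → List ℕ → List (List ℕ) → List ℕ → List (List ℕ)
lrCut m cur done []      = reverse (reverse cur ∷ done)
lrCut m cur done (a ∷ w) =
  if m <ᵇ a then lrCut a (a ∷ []) (reverse cur ∷ done) w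
            else lrCut m (a ∷ cur) done w

foataInv : List ℕ → List ℕ
foataInv []      = []
foataInv (a ∷ w) = fromCycles (suc (length w)) (lrCut a (a ∷ []) [] w)

cyc-hop : ℕ → List ℕ → List ℕ
cyc-hop x τ = foataInv (hop x (foata τ))

hop^ : ℕ → List ℕ → List ℕ
hop^ x π = if (x ∈ᵇ rixPts π) ∨ (beta1 π ==ᴹ x) then π else hop x π

cyc-hop^ : ℕ → List ℕ → List ℕ
cyc-hop^ x τ = if (app τ x == x) ∨ (head (foata τ) ==ᴹ x) then τ else cyc-hop x τ

-- Products over a subset S ⊆ [n] (S given as a characteristic vector,
-- position i ↔ letter i+1); the maps are applied for x = 1, 2, …, n in turn.

applySubset : (ℕ → List ℕ → List ℕ) → ∀ {n} → ℕ → Subset n → List ℕ → List ℕ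
applySubset f k []ᵛ          w = w
applySubset f k (true ∷ᵛ bs)  w = applySubset f (suc k) bs (f k w)
applySubset f k (false ∷ᵛ bs) w = applySubset f (suc k) bs w

VHOrbit : ℕ → List ℕ → List ℕ → Set
VHOrbit n π σ = ∃ λ (S : Subset n) → applySubset hop 1 S π ≡ σ

VHOrbit^ : ℕ → List ℕ → List ℕ → Set
VHOrbit^ n π σ = ∃ λ (S : Subset n) → applySubset hop^ 1 S π ≡ σ

CVHOrbit : ℕ → List ℕ → List ℕ → Set
CVHOrbit n τ σ = ∃ λ (S : Subset n) → applySubset cyc-hop 1 S τ ≡ σ

CVHOrbit^ : ℕ → List ℕ → List ℕ → Set
CVHOrbit^ n τ σ = ∃ λ (S : Subset n) → applySubset cyc-hop^ 1 S τ ≡ σ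

ImageEq : (List ℕ → List ℕ) → (List ℕ → Set) → (List ℕ → Set) → Set
ImageEq f A B = (∀ σ → A σ → B (f σ)) × (∀ τ → B τ → ∃ λ σ → A σ × f σ ≡ τ)

-- Read a word without repeated letters as a decreasing binary tree. Hopping at x exchanges the subtrees of
-- the node x when exactly one of them is empty, so valley-hopping orbits are trees up to such exchanges.
-- Splitting π at its largest letter n, the word F = o ∘ Φ satisfies
--   F (L n) = F (L) n,   F (n R) = n rev(R),   F (L n R) = F (R) n rev(L)   (L, R nonempty).
-- By induction F is surjective and F (π) is hop-equivalent to rev(π); as reversal commutes with hopping,
-- (a) follows. In the third case Rix(π) = Rix(R), in the second it is empty, in the first Rix(L) ∪ {n}:
-- hence away from Rix(π) and β₁(π) the same recursion shows that F commutes with every single hop, and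
-- (b) holds with the same subset S on both sides.

module Submission where

open import Defs
open import Data.Bool using (T?; Bool; true; false; if_then_else_; _∧_; _∨_; not; _xor_)
open import Data.Bool.Properties using (xor-same; xor-identityʳ; ∨-zeroʳ)
open import Data.List using (List; []; _∷_; _++_; [_]; reverse; length; map; upTo; concat; applyUpTo; take; takeWhileᵇ; dropWhileᵇ; filterᵇ)
open import Data.List.Membership.Propositional using (_∈_; _∉_)
open import Data.List.Membership.Propositional.Properties using (∈-++⁺ˡ; ∈-++⁺ʳ; ∈-++⁻; ∈-insert; ∈-∃++; ∈-map⁺; ∈-map⁻; ∈-upTo⁺; ∈-upTo⁻; ∈-concat⁺′; ∈-concat⁻′)
open import Data.List.Properties using (filter-++; ++-assoc; ++-identityʳ; unfold-reverse; reverse-++; reverse-involutive; length-++; length-map; length-upTo; upTo-∷ʳ; map-upTo; map-applyUpTo; map-++; concat-++; map-cong)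
open import Data.List.Relation.Binary.Disjoint.Propositional using (Disjoint)
open import Data.List.Relation.Binary.Permutation.Propositional using (_↭_; ↭-refl; ↭-sym; ↭-trans; ↭-reflexive; prep; swap)
import Data.List.Relation.Binary.Permutation.Propositional as ↭
open import Data.List.Relation.Binary.Permutation.Propositional.Properties using (∈-resp-↭; All-resp-↭; ↭-length; ↭-reverse; ++⁺; ++⁺ʳ; ++⁺ˡ; ++-comm; shift; shifts)
open import Data.List.Relation.Unary.All as All using (All; []; _∷_)
import Data.List.Relation.Unary.All.Properties as All
open import Data.List.Relation.Unary.Any using (here; there)
open import Data.List.Relation.Unary.AllPairs using ([]; _∷_)
open import Data.List.Relation.Unary.Unique.Propositional using (Unique)
import Data.List.Relation.Unary.Unique.Propositional.Properties as Unique
open import Data.Maybe using (Maybe; just; nothing; fromMaybe) renaming (map to mapᴹ)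
open import Data.Maybe.Relation.Unary.All as Maybe using (just; nothing)
open import Data.Nat using (ℕ; zero; suc; _+_; _∸_; _⊔_; _≤_; _<_; z≤n; s≤s; _<?_; _≟_)
open import Data.Nat.Properties hiding (_≟_; _<?_)
open import Data.List.Membership.DecPropositional _≟_ using (_∈?_)
open import Data.Product using (_×_; _,_; ∃; ∃₂; proj₁; proj₂)
open import Data.Sum using (_⊎_; inj₁; inj₂; [_,_]′)
open import Data.Vec renaming ([] to []ᵛ; _∷_ to _∷ᵛ_) using ()
open import Data.Fin.Subset using (Subset)
open import Function using (_∘_)
open import Relation.Nullary using (does; yes; no; contradiction)
open import Relation.Nullary.Decidable using (dec-true; dec-false)
open import Relation.Binary.PropositionalEquality hiding ([_])

-- The three equations come from following the largest letter `n` through the rix-factorization. As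
-- last letter it is never a descent, so every cut stays where it was and `n` becomes one more rixed
-- point. As first letter of a longer word it is the largest descent with nothing before it, so the
-- algorithm stops and the whole word is `δ`. Otherwise the first factor is `L n`, with cycle
-- `n rev(L)`; its maximum exceeds all others, so the canonical form lists it last although it was
-- produced first. Parts (a) and (b) need separate arguments because `F` need not commute with a hop
-- at a letter of `Rix` or at `β₁`: hopping `n` in `L n` gives `n L`, which `F` sends to `n rev(L)`,
-- whereas hopping `n` in `F(L) n` gives `n F(L)`. In (a) the set of hopped letters therefore
-- changes, and the comparison with `rev(π)` supplies the new one.

if-true : ∀ {A : Set} {c} {x y : A} → c ≡ true → (if c then x else y) ≡ x
if-true refl = refl

if-false : ∀ {A : Set} {c} {x y : A} → c ≡ false → (if c then x else y) ≡ y
if-false refl = refl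

<ᵇ-true : ∀ {m n} → m < n → (m <ᵇ n) ≡ true
<ᵇ-true {m} {n} = dec-true (m <? n)

<ᵇ-false : ∀ {m n} → n ≤ m → (m <ᵇ n) ≡ false
<ᵇ-false {m} {n} n≤m = dec-false (m <? n) (≤⇒≯ n≤m)

==-refl : ∀ x → (x == x) ≡ true
==-refl x = dec-true (x ≟ x) refl

==-false : ∀ {x y} → x ≢ y → (x == y) ≡ false
==-false {x} {y} = dec-false (x ≟ y)

<-lookup : ∀ {x y w} → All (_< x) w → y ∈ w → y ≢ x
<-lookup w<x y∈w refl = <-irrefl refl (All.lookup w<x y∈w)

reverse-All : ∀ {P : ℕ → Set} {w} → All P w → All P (reverse w)
reverse-All {w = w} = All-resp-↭ (↭-sym (↭-reverse w))

unique-++⁻ : ∀ (xs : List ℕ) {ys} → Unique (xs ++ ys) → Unique xs × Unique ys × Disjoint xs ys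
unique-++⁻ [] u = [] , u , λ { (() , _) }
unique-++⁻ (x ∷ xs) (x# ∷ u) with unique-++⁻ xs u
... | uxs , uys , disj =
  All.++⁻ˡ xs x# ∷ uxs , uys ,
  λ { (here refl , v∈ys) → All.lookup (All.++⁻ʳ xs x#) v∈ys refl
    ; (there v∈xs , v∈ys) → disj (v∈xs , v∈ys) }

unique-resp-↭ : {xs ys : List ℕ} → xs ↭ ys → Unique xs → Unique ys
unique-resp-↭ ↭.refl u = u
unique-resp-↭ (prep x p) (x# ∷ u) = All-resp-↭ p x# ∷ unique-resp-↭ p u
unique-resp-↭ (swap x y p) ((x≢y ∷ x#) ∷ y# ∷ u) =
  ((x≢y ∘ sym) ∷ All-resp-↭ p y#) ∷ All-resp-↭ p x# ∷ unique-resp-↭ p u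
unique-resp-↭ (↭.trans p q) u = unique-resp-↭ q (unique-resp-↭ p u)

-- Valley-hopping on words

breakAt-∉ : ∀ {x} w → x ∉ w → breakAt x w ≡ nothing
breakAt-∉ [] _ = refl
breakAt-∉ {x} (y ∷ w) x∉
  rewrite ==-false {y} {x} (λ y≡x → x∉ (here (sym y≡x))) | breakAt-∉ w (x∉ ∘ there) = refl

breakAt-++ : ∀ {x} L R → x ∉ L → breakAt x (L ++ x ∷ R) ≡ just (L , R)
breakAt-++ {x} [] R _ rewrite ==-refl x = refl
breakAt-++ {x} (y ∷ L) R x∉
  rewrite ==-false {y} {x} (λ y≡x → x∉ (here (sym y≡x))) | breakAt-++ L R (x∉ ∘ there) = refl

last-++ : ∀ L a A → last (L ++ a ∷ A) ≡ last (a ∷ A)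
last-++ [] a A = refl
last-++ (x ∷ []) a A = refl
last-++ (x ∷ y ∷ L) a A = last-++ (y ∷ L) a A

head-reverse : ∀ L → head (reverse L) ≡ last L
head-reverse [] = refl
head-reverse (a ∷ []) = refl
head-reverse (a ∷ b ∷ L) =
  trans (cong head (unfold-reverse a (b ∷ L)))
    (trans (head-++ (reverse (b ∷ L)) (trans (unfold-reverse b L) refl)) (head-reverse (b ∷ L)))
  where
  head-++ : ∀ {u v c} w → w ≡ u ++ c ∷ [] → head (w ++ v) ≡ head w
  head-++ {[]} _ refl = refl
  head-++ {_ ∷ _} _ refl = refl

module _ {x : ℕ} where

  nbLess-last : ∀ a A → All (_< x) (a ∷ A) → nbLess (last (a ∷ A)) x ≡ true
  nbLess-last a [] (a<x ∷ _) = <ᵇ-true a<x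
  nbLess-last a (b ∷ A) (_ ∷ A<x) = nbLess-last b A A<x

  nbGreater-last : ∀ a A → All (_< x) (a ∷ A) → nbGreater (last (a ∷ A)) x ≡ false
  nbGreater-last a [] (a<x ∷ _) = <ᵇ-false (<⇒≤ a<x)
  nbGreater-last a (b ∷ A) (_ ∷ A<x) = nbGreater-last b A A<x

  nbLess-big : ∀ {m} → Maybe.All (x <_) m → nbLess m x ≡ false
  nbLess-big (just x<a) = <ᵇ-false (<⇒≤ x<a)
  nbLess-big nothing = refl

  nbGreater-big : ∀ {m} → Maybe.All (x <_) m → nbGreater m x ≡ true
  nbGreater-big (just x<a) = <ᵇ-true x<a
  nbGreater-big nothing = refl

  takeWhile-< : ∀ {v} u → All (_< x) v → Maybe.All (x <_) (head u) → takeWhileᵇ (_<ᵇ x) (v ++ u) ≡ v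
  takeWhile-< u (a<x ∷ v<x) x<u rewrite <ᵇ-true a<x = cong (_ ∷_) (takeWhile-< u v<x x<u)
  takeWhile-< [] [] _ = refl
  takeWhile-< (a ∷ u) [] (just x<a) rewrite <ᵇ-false (<⇒≤ x<a) = refl

  dropWhile-< : ∀ {v} u → All (_< x) v → Maybe.All (x <_) (head u) → dropWhileᵇ (_<ᵇ x) (v ++ u) ≡ u
  dropWhile-< u (a<x ∷ v<x) x<u rewrite <ᵇ-true a<x = dropWhile-< u v<x x<u
  dropWhile-< [] [] _ = refl
  dropWhile-< (a ∷ u) [] (just x<a) rewrite <ᵇ-false (<⇒≤ x<a) = refl

  hop-just : ∀ {w} P Q → breakAt x w ≡ just (P , Q) →
    hop x w ≡ (if (nbLess (last P) x ∧ nbGreater (head Q) x) ∨ (nbGreater (last P) x ∧ nbLess (head Q) x)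
               then reverse (dropWhileᵇ (_<ᵇ x) (reverse P)) ++ takeWhileᵇ (_<ᵇ x) Q
                      ++ x ∷ reverse (takeWhileᵇ (_<ᵇ x) (reverse P)) ++ dropWhileᵇ (_<ᵇ x) Q
               else w)
  hop-just P Q eq rewrite eq = refl

  -- The arguments stand for the blocks of smaller letters on either side of `x`. Two nonempty
  -- blocks make a peak, two empty ones a valley, and only a single nonempty block changes sides.
  turn : List ℕ → List ℕ → List ℕ
  turn [] B = B ++ [ x ]
  turn A [] = x ∷ A
  turn A B = A ++ x ∷ B

  -- The bounds on `last L` and `head R` make `A` and `B` the maximal blocks below `x`; they hold
  -- vacuously for `nothing`, which encodes the infinite letters at both ends. `x ∉ L` is there
  -- because `breakAt` stops at the first occurrence.
  hop-local : ∀ L A B R → x ∉ L → All (_< x) A → All (_< x) B →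
    Maybe.All (x <_) (last L) → Maybe.All (x <_) (head R) →
    hop x (L ++ A ++ x ∷ B ++ R) ≡ L ++ turn A B ++ R
  hop-local L A B R x∉L A<x B<x x<L x<R =
    trans (hop-just (L ++ A) (B ++ R) split) (pick A B A<x B<x refl)
    where
    split : breakAt x (L ++ A ++ x ∷ B ++ R) ≡ just (L ++ A , B ++ R)
    split = trans (cong (breakAt x) (sym (++-assoc L A _)))
      (breakAt-++ (L ++ A) (B ++ R)
        ([ x∉L , (λ x∈A → <-lookup A<x x∈A refl) ]′ ∘ ∈-++⁻ L))
    x<L′ : Maybe.All (x <_) (head (reverse L))
    x<L′ = subst (Maybe.All (x <_)) (sym (head-reverse L)) x<L
    w₁ : ∀ {A} → All (_< x) A → reverse (dropWhileᵇ (_<ᵇ x) (reverse (L ++ A))) ≡ L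
    w₁ {A} A<x rewrite reverse-++ L A | dropWhile-< (reverse L) (reverse-All A<x) x<L′ = reverse-involutive L
    w₂ : ∀ {A} → All (_< x) A → reverse (takeWhileᵇ (_<ᵇ x) (reverse (L ++ A))) ≡ A
    w₂ {A} A<x rewrite reverse-++ L A | takeWhile-< (reverse L) (reverse-All A<x) x<L′ = reverse-involutive A
    hopped : ∀ {A B} → All (_< x) A → All (_< x) B →
      reverse (dropWhileᵇ (_<ᵇ x) (reverse (L ++ A))) ++ takeWhileᵇ (_<ᵇ x) (B ++ R)
        ++ x ∷ reverse (takeWhileᵇ (_<ᵇ x) (reverse (L ++ A))) ++ dropWhileᵇ (_<ᵇ x) (B ++ R)
      ≡ L ++ B ++ x ∷ A ++ R
    hopped A<x B<x rewrite w₁ A<x | w₂ A<x | takeWhile-< R B<x x<R | dropWhile-< R B<x x<R = refl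
    pick : ∀ A B → All (_< x) A → All (_< x) B → ∀ {w} → w ≡ L ++ A ++ x ∷ B ++ R →
      (if (nbLess (last (L ++ A)) x ∧ nbGreater (head (B ++ R)) x)
            ∨ (nbGreater (last (L ++ A)) x ∧ nbLess (head (B ++ R)) x)
       then reverse (dropWhileᵇ (_<ᵇ x) (reverse (L ++ A))) ++ takeWhileᵇ (_<ᵇ x) (B ++ R)
              ++ x ∷ reverse (takeWhileᵇ (_<ᵇ x) (reverse (L ++ A))) ++ dropWhileᵇ (_<ᵇ x) (B ++ R)
       else w) ≡ L ++ turn A B ++ R
    pick [] [] _ _ refl
      rewrite ++-identityʳ L | nbLess-big x<L | nbGreater-big x<L | nbLess-big x<R = refl
    pick [] (b ∷ B) _ B<x@(b<x ∷ _) refl =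
      trans (if-true cond)
        (trans (hopped [] B<x) (cong (λ v → L ++ b ∷ v) (sym (++-assoc B [ x ] R))))
      where
      cond : (nbLess (last (L ++ [])) x ∧ (x <ᵇ b)) ∨ (nbGreater (last (L ++ [])) x ∧ (b <ᵇ x)) ≡ true
      cond rewrite ++-identityʳ L | nbLess-big x<L | nbGreater-big x<L = <ᵇ-true b<x
    pick (a ∷ A) [] A<x _ refl =
      trans (if-true cond) (hopped A<x [])
      where
      cond : (nbLess (last (L ++ a ∷ A)) x ∧ nbGreater (head R) x)
               ∨ (nbGreater (last (L ++ a ∷ A)) x ∧ nbLess (head R) x) ≡ true
      cond rewrite last-++ L a A | nbLess-last a A A<x | nbGreater-big x<R = refl
    pick (a ∷ A) (b ∷ B) A<x (b<x ∷ _) refl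
      rewrite last-++ L a A | nbLess-last a A A<x | nbGreater-last a A A<x | <ᵇ-false (<⇒≤ b<x)
      = cong (λ v → L ++ a ∷ v) (sym (++-assoc A (x ∷ b ∷ B) R))

hop-∉ : ∀ {x w} → x ∉ w → hop x w ≡ w
hop-∉ {x} {w} x∉ rewrite breakAt-∉ w x∉ = refl

-- Decreasing trees. A nonempty word without repeated letters splits at its largest letter, and x is a
-- valley, double ascent, double descent or peak according to which of its two subtrees are present.

data Tree : Set where
  one  : ℕ → Tree
  asc  : Tree → ℕ → Tree
  desc : ℕ → Tree → Tree
  peak : Tree → ℕ → Tree → Tree

flat : Tree → List ℕ
flat (one x)      = [ x ]
flat (asc l x)    = flat l ++ [ x ]
flat (desc x r)   = x ∷ flat r
flat (peak l x r) = flat l ++ x ∷ flat r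

-- Strict bounds already separate a root from the letters below it; a letter could repeat only
-- across the two subtrees of a peak, hence `Disjoint` there.
data Decreasing (b : ℕ) : Tree → Set where
  one  : ∀ {x} → x < b → Decreasing b (one x)
  asc  : ∀ {l x} → Decreasing x l → x < b → Decreasing b (asc l x)
  desc : ∀ {x r} → x < b → Decreasing x r → Decreasing b (desc x r)
  peak : ∀ {l x r} → Decreasing x l → x < b → Decreasing x r → Disjoint (flat l) (flat r) →
         Decreasing b (peak l x r)

decreasing-wk : ∀ {b c t} → b ≤ c → Decreasing b t → Decreasing c t
decreasing-wk b≤c (one x<b) = one (<-≤-trans x<b b≤c)
decreasing-wk b≤c (asc l x<b) = asc l (<-≤-trans x<b b≤c)
decreasing-wk b≤c (desc x<b r) = desc (<-≤-trans x<b b≤c) r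
decreasing-wk b≤c (peak l x<b r d) = peak l (<-≤-trans x<b b≤c) r d

flat<b : ∀ {b t} → Decreasing b t → All (_< b) (flat t)
flat<b (one x<b) = x<b ∷ []
flat<b (asc l x<b) = All.++⁺ (flat<b (decreasing-wk (<⇒≤ x<b) l)) (x<b ∷ [])
flat<b (desc x<b r) = x<b ∷ flat<b (decreasing-wk (<⇒≤ x<b) r)
flat<b (peak l x<b r _) =
  All.++⁺ (flat<b (decreasing-wk (<⇒≤ x<b) l)) (x<b ∷ flat<b (decreasing-wk (<⇒≤ x<b) r))

nonempty : ∀ t → ∃₂ λ a w → flat t ≡ a ∷ w
nonempty (one x) = x , [] , refl
nonempty (asc l x) with nonempty l
... | a , w , eq rewrite eq = a , _ , refl
nonempty (desc x r) = x , _ , refl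
nonempty (peak l x r) with nonempty l
... | a , w , eq rewrite eq = a , _ , refl

-- Induction on the bound rather than the word: if the top value `b` does not occur the bound drops
-- by one, otherwise it is the largest letter and the word splits there.
fromWord : ∀ b w → Unique w → All (_< b) w → w ≡ [] ⊎ ∃ λ t → Decreasing b t × flat t ≡ w
fromWord b [] _ _ = inj₁ refl
fromWord zero (_ ∷ _) _ (() ∷ _)
fromWord (suc b) w@(_ ∷ _) u w<b with b ∈? w
... | no b∉w with fromWord b w u (All.tabulate λ {y} y∈w → ≤∧≢⇒< (≤-pred (All.lookup w<b y∈w)) λ { refl → b∉w y∈w })
...   | inj₂ (t , dec , eq) = inj₂ (t , decreasing-wk (n≤1+n b) dec , eq)
fromWord (suc b) w@(_ ∷ _) u w<b | yes b∈w with ∈-∃++ b∈w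
... | L , R , eq = inj₂ (glue (fromWord b L uL L<b) (fromWord b R uR R<b))
  where
  u′ = unique-++⁻ L (subst Unique eq u)
  w<b′ = subst (All (_< suc b)) eq w<b
  b∉L : b ∉ L
  b∉L b∈L = proj₂ (proj₂ u′) (b∈L , here refl)
  uL = proj₁ u′
  b∉R = Unique.Unique[x∷xs]⇒x∉xs (proj₁ (proj₂ u′))
  uR : Unique R
  uR with proj₁ (proj₂ u′)
  ... | _ ∷ uR = uR
  L<b : All (_< b) L
  L<b = All.tabulate λ {y} y∈ → ≤∧≢⇒< (≤-pred (All.lookup (All.++⁻ˡ L w<b′) y∈)) λ { refl → b∉L y∈ }
  R<b : All (_< b) R
  R<b = All.tabulate λ {y} y∈ → ≤∧≢⇒< (≤-pred (All.lookup (All.++⁻ʳ L w<b′) (there y∈))) λ { refl → b∉R y∈ }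
  glue : L ≡ [] ⊎ ∃ (λ t → Decreasing b t × flat t ≡ L) → R ≡ [] ⊎ ∃ (λ t → Decreasing b t × flat t ≡ R) →
         ∃ λ t → Decreasing (suc b) t × flat t ≡ w
  glue (inj₁ refl) (inj₁ refl) = one b , one ≤-refl , sym eq
  glue (inj₂ (l , dl , refl)) (inj₁ refl) = asc l b , asc dl ≤-refl , sym eq
  glue (inj₁ refl) (inj₂ (r , dr , refl)) = desc b r , desc ≤-refl dr , sym eq
  glue (inj₂ (l , dl , refl)) (inj₂ (r , dr , refl)) =
    peak l b r , peak dl ≤-refl dr (λ (v∈l , v∈r) → proj₂ (proj₂ u′) (v∈l , there v∈r)) , sym eq

-- Simultaneous hops on trees

hopᵗ : (ℕ → Bool) → Tree → Tree
hopᵗ p (one x)      = one x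
hopᵗ p (asc l x)    = if p x then desc x (hopᵗ p l) else asc (hopᵗ p l) x
hopᵗ p (desc x r)   = if p x then asc (hopᵗ p r) x else desc x (hopᵗ p r)
hopᵗ p (peak l x r) = peak (hopᵗ p l) x (hopᵗ p r)

hopᵗ-↭ : ∀ p t → flat (hopᵗ p t) ↭ flat t
hopᵗ-↭ p (one x) = ↭-refl
hopᵗ-↭ p (asc l x) with p x
... | true  = ↭-trans (prep x (hopᵗ-↭ p l)) (++-comm [ x ] (flat l))
... | false = ++⁺ʳ [ x ] (hopᵗ-↭ p l)
hopᵗ-↭ p (desc x r) with p x
... | true  = ↭-trans (++⁺ʳ [ x ] (hopᵗ-↭ p r)) (++-comm (flat r) [ x ])
... | false = prep x (hopᵗ-↭ p r)
hopᵗ-↭ p (peak l x r) = ++⁺ (hopᵗ-↭ p l) (prep x (hopᵗ-↭ p r))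

disjoint-↭ : {xs ys xs′ ys′ : List ℕ} → xs′ ↭ xs → ys′ ↭ ys → Disjoint xs ys → Disjoint xs′ ys′
disjoint-↭ p q d (v∈xs , v∈ys) = d (∈-resp-↭ p v∈xs , ∈-resp-↭ q v∈ys)

hopᵗ-decreasing : ∀ p {b t} → Decreasing b t → Decreasing b (hopᵗ p t)
hopᵗ-decreasing p (one x<b) = one x<b
hopᵗ-decreasing p (asc {x = x} l x<b) with p x
... | true  = desc x<b (hopᵗ-decreasing p l)
... | false = asc (hopᵗ-decreasing p l) x<b
hopᵗ-decreasing p (desc {x = x} x<b r) with p x
... | true  = asc (hopᵗ-decreasing p r) x<b
... | false = desc x<b (hopᵗ-decreasing p r)
hopᵗ-decreasing p (peak {l} {x} {r} dl x<b dr d) =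
  peak (hopᵗ-decreasing p dl) x<b (hopᵗ-decreasing p dr) (disjoint-↭ (hopᵗ-↭ p l) (hopᵗ-↭ p r) d)

hopᵗ-cong : ∀ {p q} t → (∀ {y} → y ∈ flat t → p y ≡ q y) → hopᵗ p t ≡ hopᵗ q t
hopᵗ-cong (one x) e = refl
hopᵗ-cong (asc l x) e rewrite e (∈-insert (flat l)) | hopᵗ-cong l (e ∘ ∈-++⁺ˡ) = refl
hopᵗ-cong (desc x r) e rewrite e (here refl) | hopᵗ-cong r (e ∘ there) = refl
hopᵗ-cong (peak l x r) e
  rewrite hopᵗ-cong l (e ∘ ∈-++⁺ˡ) | hopᵗ-cong r (e ∘ ∈-++⁺ʳ (flat l) ∘ there) = refl

hopᵗ-false : ∀ t → hopᵗ (λ _ → false) t ≡ t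
hopᵗ-false (one x) = refl
hopᵗ-false (asc l x) rewrite hopᵗ-false l = refl
hopᵗ-false (desc x r) rewrite hopᵗ-false r = refl
hopᵗ-false (peak l x r) rewrite hopᵗ-false l | hopᵗ-false r = refl

hopᵗ-id : ∀ {p} t → (∀ {y} → y ∈ flat t → p y ≡ false) → hopᵗ p t ≡ t
hopᵗ-id t e = trans (hopᵗ-cong t e) (hopᵗ-false t)

hopᵗ-∉ : ∀ {x} t → x ∉ flat t → hopᵗ (_== x) t ≡ t
hopᵗ-∉ {x} t x∉ = hopᵗ-id t λ {y} y∈ → ==-false {y} {x} λ { refl → x∉ y∈ }

-- A hop toggles the side of an only child and leaves it an only child, so hops compose by symmetric
-- difference of their letter sets. Symmetry and transitivity of `_~_` rest on this.
hopᵗ-∘ : ∀ p q t → hopᵗ p (hopᵗ q t) ≡ hopᵗ (λ y → p y xor q y) t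
hopᵗ-∘ p q (one x) = refl
hopᵗ-∘ p q (asc l x) with q x
... | true with p x
...   | true  = cong (λ l → asc l x) (hopᵗ-∘ p q l)
...   | false = cong (desc x) (hopᵗ-∘ p q l)
hopᵗ-∘ p q (asc l x) | false with p x
...   | true  = cong (desc x) (hopᵗ-∘ p q l)
...   | false = cong (λ l → asc l x) (hopᵗ-∘ p q l)
hopᵗ-∘ p q (desc x r) with q x
... | true with p x
...   | true  = cong (desc x) (hopᵗ-∘ p q r)
...   | false = cong (λ r → asc r x) (hopᵗ-∘ p q r)
hopᵗ-∘ p q (desc x r) | false with p x
...   | true  = cong (λ r → asc r x) (hopᵗ-∘ p q r)
...   | false = cong (desc x) (hopᵗ-∘ p q r)
hopᵗ-∘ p q (peak l x r) = cong₂ (λ l r → peak l x r) (hopᵗ-∘ p q l) (hopᵗ-∘ p q r)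

hopᵗ-involutive : ∀ p t → hopᵗ p (hopᵗ p t) ≡ t
hopᵗ-involutive p t = trans (hopᵗ-∘ p p t) (hopᵗ-id t λ {y} _ → xor-same (p y))

turn-asc : ∀ x t → turn {x} (flat t) [] ≡ x ∷ flat t
turn-asc x t with nonempty t
... | a , w , eq rewrite eq = refl

turn-peak : ∀ x s t → turn {x} (flat s) (flat t) ≡ flat s ++ x ∷ flat t
turn-peak x s t with nonempty s | nonempty t
... | _ , _ , eq | _ , _ , eq′ rewrite eq | eq′ = refl

-- Descending into a subtree makes its parent a neighbouring letter of the context, so the induction
-- carries `L` and `R` along. The bound `b ≤` is weak because the parent itself becomes the new `b`.
hop-in-context : ∀ {b x} L t R → Decreasing b t → x ∈ flat t → x ∉ L →
  Maybe.All (b ≤_) (last L) → Maybe.All (b ≤_) (head R) →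
  hop x (L ++ flat t ++ R) ≡ L ++ flat (hopᵗ (_== x) t) ++ R
hop-in-context L (one y) R (one y<b) (here refl) x∉L b≤L b≤R =
  hop-local L [] [] R x∉L [] [] (Maybe.map (<-≤-trans y<b) b≤L) (Maybe.map (<-≤-trans y<b) b≤R)
hop-in-context {b} {x} L (asc l y) R (asc dl y<b) x∈t x∉L b≤L b≤R with ∈-++⁻ (flat l) x∈t
... | inj₁ x∈l rewrite ==-false {y} {x} (λ { refl → <-lookup (flat<b dl) x∈l refl })
                     | ++-assoc (flat l) [ y ] R | ++-assoc (flat (hopᵗ (_== x) l)) [ y ] R =
  hop-in-context L l (y ∷ R) dl x∈l x∉L (Maybe.map (≤-trans (<⇒≤ y<b)) b≤L) (just ≤-refl)
... | inj₂ (here refl)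
  rewrite ==-refl x | hopᵗ-∉ l (λ x∈l → <-lookup (flat<b dl) x∈l refl) | ++-assoc (flat l) [ x ] R =
  trans (hop-local L (flat l) [] R x∉L (flat<b dl) [] (Maybe.map (<-≤-trans y<b) b≤L) (Maybe.map (<-≤-trans y<b) b≤R))
    (cong (λ v → L ++ v ++ R) (turn-asc x l))
hop-in-context {b} {x} L (desc y r) R (desc y<b dr) (here refl) x∉L b≤L b≤R
  rewrite ==-refl y | hopᵗ-∉ r (λ x∈r → <-lookup (flat<b dr) x∈r refl) =
  hop-local L [] (flat r) R x∉L [] (flat<b dr) (Maybe.map (<-≤-trans y<b) b≤L) (Maybe.map (<-≤-trans y<b) b≤R)
hop-in-context {b} {x} L (desc y r) R (desc y<b dr) (there x∈r) x∉L b≤L b≤R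
  rewrite ==-false {y} {x} (λ { refl → <-lookup (flat<b dr) x∈r refl }) =
  trans (cong (hop x) (sym (++-assoc L [ y ] _)))
    (trans (hop-in-context (L ++ [ y ]) r R dr x∈r
             ([ x∉L , (λ { (here refl) → <-lookup (flat<b dr) x∈r refl }) ]′ ∘ ∈-++⁻ L)
             (subst (Maybe.All (y ≤_)) (sym (last-++ L y [])) (just ≤-refl))
             (Maybe.map (≤-trans (<⇒≤ y<b)) b≤R))
      (++-assoc L [ y ] _))
hop-in-context {b} {x} L (peak l y r) R (peak dl y<b dr d) x∈t x∉L b≤L b≤R with ∈-++⁻ (flat l) x∈t
... | inj₁ x∈l rewrite hopᵗ-∉ r (λ x∈r → d (x∈l , x∈r))
                     | ++-assoc (flat l) (y ∷ flat r) R | ++-assoc (flat (hopᵗ (_== x) l)) (y ∷ flat r) R =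
  hop-in-context L l (y ∷ flat r ++ R) dl x∈l x∉L (Maybe.map (≤-trans (<⇒≤ y<b)) b≤L) (just ≤-refl)
... | inj₂ (here refl)
  rewrite hopᵗ-∉ l (λ x∈l → <-lookup (flat<b dl) x∈l refl)
        | hopᵗ-∉ r (λ x∈r → <-lookup (flat<b dr) x∈r refl) | ++-assoc (flat l) (x ∷ flat r) R =
  trans (hop-local L (flat l) (flat r) R x∉L (flat<b dl) (flat<b dr)
           (Maybe.map (<-≤-trans y<b) b≤L) (Maybe.map (<-≤-trans y<b) b≤R))
    (cong (L ++_) (trans (cong (_++ R) (turn-peak x l r)) (++-assoc (flat l) (x ∷ flat r) R)))
... | inj₂ (there x∈r) rewrite hopᵗ-∉ l (λ x∈l → d (x∈l , x∈r)) =
  trans (cong (hop x) (shuffle (flat r)))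
    (trans (hop-in-context ((L ++ flat l) ++ [ y ]) r R dr x∈r
             ([ [ x∉L , (λ x∈l → d (x∈l , x∈r)) ]′ ∘ ∈-++⁻ L , (λ { (here refl) → <-lookup (flat<b dr) x∈r refl }) ]′
               ∘ ∈-++⁻ (L ++ flat l))
             (subst (Maybe.All (y ≤_)) (sym (last-++ (L ++ flat l) y [])) (just ≤-refl))
             (Maybe.map (≤-trans (<⇒≤ y<b)) b≤R))
      (sym (shuffle (flat (hopᵗ (_== x) r)))))
  where
  shuffle : ∀ v → L ++ (flat l ++ y ∷ v) ++ R ≡ ((L ++ flat l) ++ [ y ]) ++ v ++ R
  shuffle v = trans (cong (L ++_) (++-assoc (flat l) (y ∷ v) R))
    (trans (sym (++-assoc L (flat l) _)) (sym (++-assoc (L ++ flat l) [ y ] (v ++ R))))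

hop-flat : ∀ {b} x t → Decreasing b t → hop x (flat t) ≡ flat (hopᵗ (_== x) t)
hop-flat x t dec with x ∈? flat t
... | no x∉t = trans (hop-∉ x∉t) (cong flat (sym (hopᵗ-∉ t x∉t)))
... | yes x∈t =
  trans (cong (hop x) (sym (++-identityʳ (flat t))))
    (trans (hop-in-context [] t [] dec x∈t (λ ()) nothing nothing) (++-identityʳ _))

-- Reversal of words as reflection of trees

mirror : Tree → Tree
mirror (one x)      = one x
mirror (asc l x)    = desc x (mirror l)
mirror (desc x r)   = asc (mirror r) x
mirror (peak l x r) = peak (mirror r) x (mirror l)

flat-mirror : ∀ t → flat (mirror t) ≡ reverse (flat t)
flat-mirror (one x) = refl
flat-mirror (asc l x) = trans (cong (x ∷_) (flat-mirror l)) (sym (reverse-++ (flat l) [ x ]))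
flat-mirror (desc x r) = trans (cong (_++ [ x ]) (flat-mirror r)) (sym (unfold-reverse x (flat r)))
flat-mirror (peak l x r) = begin
  flat (mirror r) ++ x ∷ flat (mirror l)     ≡⟨ cong₂ (λ u v → u ++ x ∷ v) (flat-mirror r) (flat-mirror l) ⟩
  reverse (flat r) ++ x ∷ reverse (flat l)   ≡⟨ ++-assoc (reverse (flat r)) [ x ] _ ⟨
  (reverse (flat r) ++ [ x ]) ++ reverse (flat l) ≡⟨ cong (_++ reverse (flat l)) (unfold-reverse x (flat r)) ⟨
  reverse (x ∷ flat r) ++ reverse (flat l)   ≡⟨ reverse-++ (flat l) (x ∷ flat r) ⟨
  reverse (flat l ++ x ∷ flat r)             ∎
  where open ≡-Reasoning

mirror-↭ : ∀ t → flat (mirror t) ↭ flat t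
mirror-↭ t = ↭-trans (↭-reflexive (flat-mirror t)) (↭-reverse (flat t))

mirror-involutive : ∀ t → mirror (mirror t) ≡ t
mirror-involutive (one x) = refl
mirror-involutive (asc l x) = cong (λ l → asc l x) (mirror-involutive l)
mirror-involutive (desc x r) = cong (desc x) (mirror-involutive r)
mirror-involutive (peak l x r) = cong₂ (λ l r → peak l x r) (mirror-involutive l) (mirror-involutive r)

mirror-decreasing : ∀ {b t} → Decreasing b t → Decreasing b (mirror t)
mirror-decreasing (one x<b) = one x<b
mirror-decreasing (asc l x<b) = desc x<b (mirror-decreasing l)
mirror-decreasing (desc x<b r) = asc (mirror-decreasing r) x<b
mirror-decreasing (peak {l} {x} {r} dl x<b dr d) =
  peak (mirror-decreasing dr) x<b (mirror-decreasing dl)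
    (disjoint-↭ (mirror-↭ r) (mirror-↭ l) λ (v∈r , v∈l) → d (v∈l , v∈r))

hopᵗ-mirror : ∀ p t → hopᵗ p (mirror t) ≡ mirror (hopᵗ p t)
hopᵗ-mirror p (one x) = refl
hopᵗ-mirror p (asc l x) with p x
... | true  = cong (λ l → asc l x) (hopᵗ-mirror p l)
... | false = cong (desc x) (hopᵗ-mirror p l)
hopᵗ-mirror p (desc x r) with p x
... | true  = cong (desc x) (hopᵗ-mirror p r)
... | false = cong (λ r → asc r x) (hopᵗ-mirror p r)
hopᵗ-mirror p (peak l x r) = cong₂ (λ r l → peak r x l) (hopᵗ-mirror p r) (hopᵗ-mirror p l)

-- The map o ∘ Φ on trees.
Φᵗ : Tree → Tree
Φᵗ (one x)      = one x
Φᵗ (asc l x)    = asc (Φᵗ l) x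
Φᵗ (desc x r)   = desc x (mirror r)
Φᵗ (peak l x r) = peak (Φᵗ r) x (mirror l)

Φᵗ-↭ : ∀ t → flat (Φᵗ t) ↭ flat t
Φᵗ-↭ (one x) = ↭-refl
Φᵗ-↭ (asc l x) = ++⁺ʳ [ x ] (Φᵗ-↭ l)
Φᵗ-↭ (desc x r) = prep x (mirror-↭ r)
Φᵗ-↭ (peak l x r) =
  ↭-trans (++⁺ (Φᵗ-↭ r) (prep x (mirror-↭ l)))
    (↭-trans (++-comm (flat r) (x ∷ flat l)) (↭-sym (shift x (flat l) (flat r))))

Φᵗ-decreasing : ∀ {b t} → Decreasing b t → Decreasing b (Φᵗ t)
Φᵗ-decreasing (one x<b) = one x<b
Φᵗ-decreasing (asc l x<b) = asc (Φᵗ-decreasing l) x<b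
Φᵗ-decreasing (desc x<b r) = desc x<b (mirror-decreasing r)
Φᵗ-decreasing (peak {l} {x} {r} dl x<b dr d) =
  peak (Φᵗ-decreasing dr) x<b (mirror-decreasing dl)
    (disjoint-↭ (Φᵗ-↭ r) (mirror-↭ l) λ (v∈r , v∈l) → d (v∈l , v∈r))

-- Solves the equations of `Φᵗ` for their argument: at a peak, the left part of an image is `Φᵗ` of
-- the original right subtree and the right part is the mirror of the original left one.
Ψᵗ : Tree → Tree
Ψᵗ (one x)      = one x
Ψᵗ (asc l x)    = asc (Ψᵗ l) x
Ψᵗ (desc x r)   = desc x (mirror r)
Ψᵗ (peak l x r) = peak (mirror r) x (Ψᵗ l)

Φᵗ-Ψᵗ : ∀ t → Φᵗ (Ψᵗ t) ≡ t
Φᵗ-Ψᵗ (one x) = refl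
Φᵗ-Ψᵗ (asc l x) = cong (λ l → asc l x) (Φᵗ-Ψᵗ l)
Φᵗ-Ψᵗ (desc x r) = cong (desc x) (mirror-involutive r)
Φᵗ-Ψᵗ (peak l x r) = cong₂ (λ l r → peak l x r) (Φᵗ-Ψᵗ l) (mirror-involutive r)

Ψᵗ-↭ : ∀ t → flat (Ψᵗ t) ↭ flat t
Ψᵗ-↭ t = ↭-trans (↭-sym (Φᵗ-↭ (Ψᵗ t))) (↭-reflexive (cong flat (Φᵗ-Ψᵗ t)))

Ψᵗ-decreasing : ∀ {b t} → Decreasing b t → Decreasing b (Ψᵗ t)
Ψᵗ-decreasing (one x<b) = one x<b
Ψᵗ-decreasing (asc l x<b) = asc (Ψᵗ-decreasing l) x<b
Ψᵗ-decreasing (desc x<b r) = desc x<b (mirror-decreasing r)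
Ψᵗ-decreasing (peak {l} {x} {r} dl x<b dr d) =
  peak (mirror-decreasing dr) x<b (Ψᵗ-decreasing dl)
    (disjoint-↭ (mirror-↭ r) (Ψᵗ-↭ l) λ (v∈r , v∈l) → d (v∈l , v∈r))

-- Hop-equivalence of trees

infix 4 _~_

record _~_ (t u : Tree) : Set where
  constructor by
  field
    letters : ℕ → Bool
    hopped  : hopᵗ letters t ≡ u

-- At a node with one child reversal moves the root to the other side and `Φᵗ` does not, so the root
-- is hopped. At a peak both exchange the subtrees, and only the image of `r` needs correction.
Φᵗ-mirror : ∀ {b t} → Decreasing b t → mirror t ~ Φᵗ t
Φᵗ-mirror (one x<b) = by (λ _ → false) refl
Φᵗ-mirror (asc {l} {x} dl x<b) with Φᵗ-mirror dl
... | by p eq = by q eq′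
  where
  -- The value of `p` at `x` is unknown, so it is overridden; the letters of `l` lie below `x` and
  -- keep theirs.
  q : ℕ → Bool
  q y = if y == x then true else p y
  q≡p : ∀ {y} → y ∈ flat (mirror l) → q y ≡ p y
  q≡p y∈ = if-false (==-false (<-lookup (flat<b dl) (∈-resp-↭ (mirror-↭ l) y∈)))
  eq′ : hopᵗ q (desc x (mirror l)) ≡ asc (Φᵗ l) x
  eq′ rewrite ==-refl x = cong (λ l → asc l x) (trans (hopᵗ-cong (mirror l) q≡p) eq)
Φᵗ-mirror (desc {x} {r} x<b dr) = by (_== x) eq
  where
  eq : hopᵗ (_== x) (asc (mirror r) x) ≡ desc x (mirror r)
  eq rewrite ==-refl x =
    cong (desc x) (hopᵗ-∉ (mirror r) λ x∈ → <-lookup (flat<b dr) (∈-resp-↭ (mirror-↭ r) x∈) refl)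
Φᵗ-mirror (peak {l} {x} {r} dl x<b dr d) with Φᵗ-mirror dr
-- `p` is uncontrolled on the letters of `l`, which must stay put, so it is cut down to those of
-- `r`.
... | by p eq = by (λ y → does (y ∈? flat r) ∧ p y)
  (cong₂ (λ r l → peak r x l)
    (trans (hopᵗ-cong (mirror r) λ {y} y∈ →
              cong (_∧ p y) (dec-true (y ∈? flat r) (∈-resp-↭ (mirror-↭ r) y∈))) eq)
    (hopᵗ-id (mirror l) λ {y} y∈ →
              cong (_∧ p y) (dec-false (y ∈? flat r) λ y∈r → d (∈-resp-↭ (mirror-↭ l) y∈ , y∈r))))

-- Rixed points and `β₁` on trees

rixᵗ : Tree → List ℕ
rixᵗ (one x)      = [ x ]
rixᵗ (asc l x)    = rixᵗ l ++ [ x ]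
rixᵗ (desc x r)   = []
rixᵗ (peak l x r) = rixᵗ r

β₁ᵗ : Tree → ℕ
β₁ᵗ (one x)      = x
β₁ᵗ (asc l x)    = β₁ᵗ l
β₁ᵗ (desc x r)   = x
β₁ᵗ (peak l x r) = β₁ᵗ r

β₁ᵗ-∈ : ∀ t → β₁ᵗ t ∈ flat t
β₁ᵗ-∈ (one x) = here refl
β₁ᵗ-∈ (asc l x) = ∈-++⁺ˡ (β₁ᵗ-∈ l)
β₁ᵗ-∈ (desc x r) = here refl
β₁ᵗ-∈ (peak l x r) = ∈-++⁺ʳ (flat l) (there (β₁ᵗ-∈ r))

head-++ : ∀ u {v a} → head u ≡ just a → head (u ++ v) ≡ just a
head-++ (_ ∷ _) eq = eq

-- This matches the two exceptional letters of part (b): `β₁` on one side, the first letter after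
-- Foata's transformation on the other.
head-Φᵗ : ∀ t → head (flat (Φᵗ t)) ≡ just (β₁ᵗ t)
head-Φᵗ (one x) = refl
head-Φᵗ (asc l x) = head-++ (flat (Φᵗ l)) (head-Φᵗ l)
head-Φᵗ (desc x r) = refl
head-Φᵗ (peak l x r) = head-++ (flat (Φᵗ r)) (head-Φᵗ r)

-- Along the path that `Φᵗ` recurses on, an `asc` root is rixed and a `desc` root is `β₁`, so
-- neither is `x`. Everything off that path is merely mirrored, and mirroring commutes with hops.
Φᵗ-hopᵗ : ∀ {x} t → x ∉ rixᵗ t → x ≢ β₁ᵗ t → Φᵗ (hopᵗ (_== x) t) ≡ hopᵗ (_== x) (Φᵗ t)
Φᵗ-hopᵗ (one y) _ _ = refl
Φᵗ-hopᵗ {x} (asc l y) x∉ x≢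
  rewrite ==-false {y} {x} (λ { refl → x∉ (∈-++⁺ʳ (rixᵗ l) (here refl)) }) =
  cong (λ l → asc l y) (Φᵗ-hopᵗ l (x∉ ∘ ∈-++⁺ˡ) x≢)
Φᵗ-hopᵗ {x} (desc y r) _ x≢ rewrite ==-false {y} {x} (x≢ ∘ sym) =
  cong (desc y) (sym (hopᵗ-mirror (_== x) r))
Φᵗ-hopᵗ {x} (peak l y r) x∉ x≢ =
  cong₂ (λ r l → peak r y l) (Φᵗ-hopᵗ r x∉ x≢) (sym (hopᵗ-mirror (_== x) l))

-- The cycles of o⁻¹ in canonical form

cyclesᵗ : Tree → List (List ℕ)
cyclesᵗ (one x)      = [ [ x ] ]
cyclesᵗ (asc l x)    = cyclesᵗ l ++ [ [ x ] ]
cyclesᵗ (desc x r)   = [ x ∷ flat r ]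
cyclesᵗ (peak l x r) = cyclesᵗ l ++ [ x ∷ flat r ]

concat-cyclesᵗ : ∀ t → concat (cyclesᵗ t) ≡ flat t
concat-cyclesᵗ (one x) = refl
concat-cyclesᵗ (asc l x) =
  trans (sym (concat-++ (cyclesᵗ l) _)) (cong (_++ [ x ]) (concat-cyclesᵗ l))
concat-cyclesᵗ (desc x r) = ++-identityʳ _
concat-cyclesᵗ (peak l x r) =
  trans (sym (concat-++ (cyclesᵗ l) _)) (cong₂ _++_ (concat-cyclesᵗ l) (++-identityʳ _))

lrCut-≤ : ∀ {m cur done v} w → All (_< m) v → lrCut m cur done (v ++ w) ≡ lrCut m (reverse v ++ cur) done w
lrCut-≤ w [] = refl
lrCut-≤ {m} {cur} {done} {a ∷ v} w (a<m ∷ v<m)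
  rewrite <ᵇ-false (<⇒≤ a<m) | lrCut-≤ {m} {a ∷ cur} {done} w v<m | unfold-reverse a v
        | ++-assoc (reverse v) [ a ] cur = refl

cutWord : List ℕ → List (List ℕ)
cutWord []      = []
cutWord (a ∷ w) = lrCut a [ a ] [] w

-- The accumulators of `lrCut` after reading `flat t`. `read` quantifies over the continuation so
-- that trees can be extended on the right; `top` is the current left-to-right maximum, and `top<b`
-- ensures that a next letter `b` opens a new cycle.
record CutState (b : ℕ) (t : Tree) : Set where
  field
    top    : ℕ
    cur    : List ℕ
    done   : List (List ℕ)
    top<b  : top < b
    read   : ∀ w → cutWord (flat t ++ w) ≡ lrCut top cur done w
    output : reverse (reverse cur ∷ done) ≡ cyclesᵗ t

-- The letter `x` closes the open cycle and nothing in `v` closes the one it starts. `v` is empty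
-- for `asc` and the word of the right subtree for `peak`.
cutState-snoc : ∀ {b x t v} → CutState x t → x < b → All (_< x) v →
  ∃ λ (s : List ℕ × List (List ℕ)) →
    (∀ w → cutWord (flat t ++ x ∷ v ++ w) ≡ lrCut x (proj₁ s) (proj₂ s) w)
    × reverse (reverse (proj₁ s) ∷ proj₂ s) ≡ cyclesᵗ t ++ [ x ∷ v ]
cutState-snoc {x = x} {t} {v} s x<b v<x = (reverse v ++ [ x ] , reverse cur ∷ done) , read′ , output′
  where
  open CutState s
  read′ : ∀ w → cutWord (flat t ++ x ∷ v ++ w) ≡ lrCut x (reverse v ++ [ x ]) (reverse cur ∷ done) w
  read′ w rewrite read (x ∷ v ++ w) | <ᵇ-true top<b = lrCut-≤ w v<x
  output′ : reverse (reverse (reverse v ++ [ x ]) ∷ reverse cur ∷ done) ≡ cyclesᵗ t ++ [ x ∷ v ]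
  output′ rewrite reverse-++ (reverse v) [ x ] | reverse-involutive v =
    trans (unfold-reverse (x ∷ v) (reverse cur ∷ done)) (cong (_++ [ x ∷ v ]) output)

cutState : ∀ {b t} → Decreasing b t → CutState b t
cutState (one {x} x<b) = record { top<b = x<b ; read = λ _ → refl ; output = refl }
cutState (asc {l} {x} dl x<b) with cutState-snoc (cutState dl) x<b []
... | _ , read′ , output′ = record
  { top<b = x<b
  ; read = λ w → trans (cong cutWord (++-assoc (flat l) [ x ] w)) (read′ w)
  ; output = output′ }
cutState (desc {x} {r} x<b dr) = record
  { top<b = x<b
  ; read = λ w → lrCut-≤ w (flat<b dr)
  ; output = cong [_] (trans (reverse-++ (reverse (flat r)) [ x ]) (cong (x ∷_) (reverse-involutive (flat r)))) }
cutState (peak {l} {x} {r} dl x<b dr _) with cutState-snoc (cutState dl) x<b (flat<b dr)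
... | _ , read′ , output′ = record
  { top<b = x<b
  ; read = λ w → trans (cong cutWord (++-assoc (flat l) (x ∷ flat r) w)) (read′ w)
  ; output = output′ }

foataInv-flat : ∀ {b t} → Decreasing b t → foataInv (flat t) ≡ fromCycles (length (flat t)) (cyclesᵗ t)
foataInv-flat {t = t} dec =
  trans (unfold (flat t))
    (cong (fromCycles (length (flat t)))
      (trans (cong cutWord (sym (++-identityʳ (flat t)))) (trans (read []) output)))
  where
  open CutState (cutState dec)
  unfold : ∀ w → foataInv w ≡ fromCycles (length w) (cutWord w)
  unfold [] = refl
  unfold (_ ∷ _) = refl

-- The rix-factorization

∈⇒≤maxL : ∀ {x w} → x ∈ w → x ≤ maxL w
∈⇒≤maxL {w = a ∷ w} (here refl) = m≤m⊔n a (maxL w)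
∈⇒≤maxL {w = a ∷ w} (there x∈w) = ≤-trans (∈⇒≤maxL x∈w) (m≤n⊔m a (maxL w))

maxL-≡ : ∀ {x w} → x ∈ w → All (_≤ x) w → maxL w ≡ x
maxL-≡ {x} x∈w w≤x = ≤-antisym (maxL-≤ w≤x) (∈⇒≤maxL x∈w)
  where
  maxL-≤ : ∀ {w} → All (_≤ x) w → maxL w ≤ x
  maxL-≤ [] = z≤n
  maxL-≤ (a≤x ∷ w≤x) = ⊔-lub a≤x (maxL-≤ w≤x)

maxL-< : ∀ {x d ds} → All (_< x) (d ∷ ds) → maxL (d ∷ ds) < x
maxL-< {d = d} (d<x ∷ []) = subst (_< _) (sym (⊔-identityʳ d)) d<x
maxL-< (d<x ∷ ds<x@(_ ∷ _)) = ⊔-lub d<x (maxL-< ds<x)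

descents-All : ∀ {P : ℕ → Set} {w} → All P w → All P (descents w)
descents-All [] = []
descents-All (_ ∷ []) = []
descents-All {w = a ∷ b ∷ w} (pa ∷ pw) with b <ᵇ a
... | true  = pa ∷ descents-All pw
... | false = descents-All pw

descents-∈ : ∀ {x} L a R → a < x → x ∈ descents (L ++ x ∷ a ∷ R)
descents-∈ [] a R a<x rewrite <ᵇ-true a<x = here refl
descents-∈ {x} (b ∷ []) a R a<x with x <ᵇ b
... | true  = there (descents-∈ [] a R a<x)
... | false = descents-∈ [] a R a<x
descents-∈ (b ∷ c ∷ L) a R a<x with c <ᵇ b | descents-∈ (c ∷ L) a R a<x
... | true  | x∈ = there x∈
... | false | x∈ = x∈

descents-snoc : ∀ {x} w → All (_< x) w → descents (w ++ [ x ]) ≡ descents w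
descents-snoc [] _ = refl
descents-snoc (a ∷ []) (a<x ∷ _) rewrite <ᵇ-false (<⇒≤ a<x) = refl
descents-snoc (a ∷ b ∷ w) (_ ∷ w<x) rewrite descents-snoc (b ∷ w) w<x = refl

breakAt-All : ∀ {P : ℕ → Set} {x L R} w → All P w → breakAt x w ≡ just (L , R) → All P R
breakAt-All {x = x} (y ∷ w) (_ ∷ pw) eq with y == x
breakAt-All (y ∷ w) (_ ∷ pw) refl | true = pw
... | false with breakAt x w in eq′
breakAt-All (y ∷ w) (_ ∷ pw) refl | false | just _ = breakAt-All w pw eq′

breakAt-snoc : ∀ {x y} w → y ≢ x →
  breakAt y (w ++ [ x ]) ≡ mapᴹ (λ (L , R) → L , R ++ [ x ]) (breakAt y w)
breakAt-snoc [] y≢x rewrite ==-false (y≢x ∘ sym) = refl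
breakAt-snoc {x} {y} (a ∷ w) y≢x with a == y
... | true = refl
... | false rewrite breakAt-snoc w y≢x with breakAt y w
...   | nothing = refl
...   | just _ = refl

-- A trailing maximum neither is a descent nor creates one, so the cuts are unchanged and it is
-- carried along to the end of `β`.
rixAux-snoc : ∀ {x} k w → All (_< x) w →
  rixAux k (w ++ [ x ]) ≡ (proj₁ (rixAux k w) , proj₂ (rixAux k w) ++ [ x ])
rixAux-snoc zero w w<x = refl
rixAux-snoc (suc k) w w<x rewrite descents-snoc w w<x with descents w | descents-All w<x
... | [] | _ = refl
... | d ∷ ds | ds<x rewrite breakAt-snoc w (<⇒≢ (maxL-< ds<x)) with breakAt (maxL (d ∷ ds)) w in eq
...   | nothing = refl
...   | just ([] , R) = refl
...   | just (a ∷ L , R) rewrite rixAux-snoc k R (breakAt-All w w<x eq) = refl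

-- The overall maximum, when not last, is a descent and hence the largest one; a nonempty `L` lets
-- the algorithm cut after it.
rixAux-max : ∀ {x} k L a R → All (_< x) L → All (_< x) (a ∷ R) → ∀ {l L′} → L ≡ l ∷ L′ →
  rixAux (suc k) (L ++ x ∷ a ∷ R) ≡ ((L ++ [ x ]) ∷ proj₁ (rixAux k (a ∷ R)) , proj₂ (rixAux k (a ∷ R)))
rixAux-max {x} k L a R L<x R<x refl
  with descents (L ++ x ∷ a ∷ R) | descents-∈ L a R (All.head R<x)
     | descents-All (All.++⁺ (All.map <⇒≤ L<x) (≤-refl ∷ All.map <⇒≤ R<x))
... | d ∷ ds | x∈ds | ds≤x
  rewrite maxL-≡ x∈ds ds≤x | breakAt-++ L (a ∷ R) (λ x∈L → <-lookup L<x x∈L refl) =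
  cong (λ y → (L ++ [ y ]) ∷ _ , _) (maxL-≡ x∈ds ds≤x)

-- With nothing before the largest descent the algorithm stops at once; fuel `0` returns the whole
-- word as well, so `k` is arbitrary.
rixAux-max-first : ∀ {x} k a R → All (_< x) (a ∷ R) → rixAux k (x ∷ a ∷ R) ≡ ([] , x ∷ a ∷ R)
rixAux-max-first zero a R R<x = refl
rixAux-max-first {x} (suc k) a R R<x
  with descents (x ∷ a ∷ R) | descents-∈ [] a R (All.head R<x)
     | descents-All (≤-refl ∷ All.map <⇒≤ R<x)
... | d ∷ ds | x∈ds | ds≤x rewrite maxL-≡ x∈ds ds≤x | ==-refl x = refl

alphasᵗ : Tree → List (List ℕ)
alphasᵗ (one x)      = []
alphasᵗ (asc l x)    = alphasᵗ l
alphasᵗ (desc x r)   = []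
alphasᵗ (peak l x r) = (flat l ++ [ x ]) ∷ alphasᵗ r

deltaᵗ : Tree → List ℕ
deltaᵗ (one x)      = []
deltaᵗ (asc l x)    = deltaᵗ l
deltaᵗ (desc x r)   = x ∷ flat r
deltaᵗ (peak l x r) = deltaᵗ r

-- `asc` spends no fuel, as its root is only carried along. Each `peak` spends one unit, which the
-- length of its left subtree and root pays for.
rixAux-flat : ∀ {b t} k → Decreasing b t → length (flat t) ≤ k →
  rixAux k (flat t) ≡ (alphasᵗ t , deltaᵗ t ++ rixᵗ t)
rixAux-flat (suc k) (one x<b) _ = refl
rixAux-flat k (asc {l} {x} dl x<b) len
  rewrite rixAux-snoc k (flat l) (flat<b dl)
        | rixAux-flat k dl (≤-trans (m≤m+n (length (flat l)) 1) (≤-trans (≤-reflexive (sym (length-++ (flat l)))) len)) =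
  cong (alphasᵗ l ,_) (++-assoc (deltaᵗ l) (rixᵗ l) [ x ])
rixAux-flat k (desc {x} {r} x<b dr) _ with nonempty r | flat<b dr
... | a , w , eq | r<x rewrite eq = trans (rixAux-max-first k a w r<x) (cong ([] ,_) (sym (++-identityʳ _)))
rixAux-flat zero (peak {l} dl _ _ _) len with nonempty l
... | _ , _ , eq rewrite eq with len
...   | ()
rixAux-flat {t = t} (suc k) (peak {l} {x} {r} dl x<b dr _) len with nonempty l | nonempty r | rixAux-flat k dr fuel
  where
  fuel : length (flat r) ≤ k
  fuel = ≤-pred (≤-trans (m≤n+m (suc (length (flat r))) (length (flat l)))
    (≤-trans (≤-reflexive (sym (length-++ (flat l)))) len))
... | _ , _ , eq | a , w , eq′ | ih =
  trans (step (flat r) eq′ (flat<b dr)) (cong (λ p → (flat l ++ [ x ]) ∷ proj₁ p , proj₂ p) ih)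
  where
  step : ∀ R → R ≡ a ∷ w → All (_< x) R →
    rixAux (suc k) (flat l ++ x ∷ R) ≡ ((flat l ++ [ x ]) ∷ proj₁ (rixAux k R) , proj₂ (rixAux k R))
  step _ refl R<x = rixAux-max k (flat l) a w (flat<b dl) R<x eq

-- Maximal increasing suffixes and rixed points

incSuffixRev-All : ∀ {P : ℕ → Set} {w} → All P w → All P (incSuffixRev w)
incSuffixRev-All [] = []
incSuffixRev-All (pa ∷ []) = pa ∷ []
incSuffixRev-All {w = a ∷ b ∷ w} (pa ∷ pw) with b <ᵇ a
... | true  = pa ∷ incSuffixRev-All pw
... | false = pa ∷ []

incSuffixRev-cut : ∀ {x} a v u → All (_< x) (a ∷ v) → incSuffixRev ((a ∷ v) ++ x ∷ u) ≡ incSuffixRev (a ∷ v)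
incSuffixRev-cut a [] u (a<x ∷ _) rewrite <ᵇ-false (<⇒≤ a<x) = refl
incSuffixRev-cut a (b ∷ v) u (_ ∷ v<x) rewrite incSuffixRev-cut b v u v<x = refl

maxIncSuffix-snoc : ∀ {x} t → All (_< x) (flat t) → maxIncSuffix (flat t ++ [ x ]) ≡ maxIncSuffix (flat t) ++ [ x ]
maxIncSuffix-snoc {x} t t<x
  rewrite reverse-++ (flat t) [ x ] | sym (flat-mirror t)
  with nonempty (mirror t) | All-resp-↭ (↭-sym (mirror-↭ t)) t<x
... | a , w , eq | m<x rewrite eq | <ᵇ-true (All.head m<x) = unfold-reverse x (incSuffixRev (a ∷ w))

-- `x` exceeds the first letter after it, so the increasing suffix cannot reach back to `x`.
-- `mirror t` serves to expose the reversed word as nonempty.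
maxIncSuffix-cut : ∀ {x} L t → All (_< x) (flat t) → maxIncSuffix (L ++ x ∷ flat t) ≡ maxIncSuffix (flat t)
maxIncSuffix-cut {x} L t t<x
  rewrite reverse-++ L (x ∷ flat t) | unfold-reverse x (flat t) | ++-assoc (reverse (flat t)) [ x ] (reverse L)
        | sym (flat-mirror t)
  with nonempty (mirror t) | All-resp-↭ (↭-sym (mirror-↭ t)) t<x
... | a , w , eq | m<x rewrite eq = cong reverse (incSuffixRev-cut a w (reverse L) m<x)

filter-< : ∀ {x w} → All (_< x) w → filterᵇ (λ y → not (y <ᵇ x)) w ≡ []
filter-< [] = refl
filter-< (a<x ∷ w<x) rewrite <ᵇ-true a<x = filter-< w<x

-- An `asc` root extends the suffix and passes the filter. For `desc` the suffix lies in `r`, all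
-- below `β₁ = x`, so the filter empties it; for `peak` both the suffix and `β₁` come from `r`.
rixᵗ-maxIncSuffix : ∀ {b t} → Decreasing b t → filterᵇ (λ y → not (y <ᵇ β₁ᵗ t)) (maxIncSuffix (flat t)) ≡ rixᵗ t
rixᵗ-maxIncSuffix (one {x} x<b) rewrite <ᵇ-false (≤-refl {x}) = refl
rixᵗ-maxIncSuffix (asc {l} {x} dl x<b)
  rewrite maxIncSuffix-snoc l (flat<b dl)
        | filter-++ (λ y → T? (not (y <ᵇ β₁ᵗ l))) (maxIncSuffix (flat l)) [ x ]
        | rixᵗ-maxIncSuffix dl | <ᵇ-false (<⇒≤ (All.lookup (flat<b dl) (β₁ᵗ-∈ l))) = refl
rixᵗ-maxIncSuffix (desc {x} {r} x<b dr)
  rewrite maxIncSuffix-cut [] r (flat<b dr) =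
  filter-< (reverse-All (incSuffixRev-All (reverse-All (flat<b dr))))
rixᵗ-maxIncSuffix (peak {l} {x} {r} dl x<b dr _)
  rewrite maxIncSuffix-cut (flat l) r (flat<b dr) = rixᵗ-maxIncSuffix dr

-- The cycles of `Φ` read off the tree

module _ {b t} (dec : Decreasing b t) where

  rixFact-flat : rixFact (flat t) ≡ (alphasᵗ t , deltaᵗ t ++ rixᵗ t)
  rixFact-flat = rixAux-flat _ dec ≤-refl

  beta1-flat : beta1 (flat t) ≡ just (β₁ᵗ t)
  beta1-flat rewrite rixFact-flat = head-beta t
    where
    head-beta : ∀ t → head (deltaᵗ t ++ rixᵗ t) ≡ just (β₁ᵗ t)
    head-beta (one x) = refl
    head-beta (asc l x) = trans (cong head (sym (++-assoc (deltaᵗ l) (rixᵗ l) [ x ])))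
      (head-++ (deltaᵗ l ++ rixᵗ l) (head-beta l))
    head-beta (desc x r) = refl
    head-beta (peak l x r) = head-beta r

  rixPts-flat : rixPts (flat t) ≡ rixᵗ t
  rixPts-flat rewrite beta1-flat = rixᵗ-maxIncSuffix dec

  delta-flat : delta (flat t) ≡ deltaᵗ t
  delta-flat rewrite rixPts-flat | rixFact-flat | length-++ (deltaᵗ t) {rixᵗ t}
    | m+n∸n≡m (length (deltaᵗ t)) (length (rixᵗ t)) = take-length (deltaᵗ t)
    where
    take-length : ∀ (u : List ℕ) {v} → take (length u) (u ++ v) ≡ u
    take-length [] = refl
    take-length (a ∷ u) = cong (a ∷_) (take-length u)

  -- Only up to order: the factors `α` appear by decreasing maxima, while the canonical form wants
  -- increasing ones. Inside each cycle the order is already right, since reversing `l x` puts the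
  -- maximum first and mirrors `l`.
  PhiCycles-flat : PhiCycles (flat t) ↭ cyclesᵗ (Φᵗ t)
  PhiCycles-flat rewrite delta-flat | rixPts-flat | rixFact-flat = canonical t
    where
    canonical : ∀ t → map reverse (alphasᵗ t) ++ deltaCyc (deltaᵗ t) ++ map [_] (rixᵗ t) ↭ cyclesᵗ (Φᵗ t)
    canonical (one x) = ↭-refl
    canonical (asc l x)
      rewrite map-++ [_] (rixᵗ l) [ x ]
            | sym (++-assoc (deltaCyc (deltaᵗ l)) (map [_] (rixᵗ l)) [ [ x ] ])
            | sym (++-assoc (map reverse (alphasᵗ l)) (deltaCyc (deltaᵗ l) ++ map [_] (rixᵗ l)) [ [ x ] ]) =
      ++⁺ʳ [ [ x ] ] (canonical l)
    canonical (desc x r) = ↭-reflexive (cong (λ w → [ x ∷ w ]) (sym (flat-mirror r)))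
    canonical (peak l x r) rewrite reverse-++ (flat l) [ x ] | flat-mirror l =
      ↭-trans (prep _ (canonical r)) (++-comm [ x ∷ reverse (flat l) ] (cyclesᵗ (Φᵗ r)))

∈-singletonᶜ⁺ : ∀ {x} t → x ∈ rixᵗ t → [ x ] ∈ cyclesᵗ (Φᵗ t)
∈-singletonᶜ⁺ (one y) (here refl) = here refl
∈-singletonᶜ⁺ (asc l y) x∈ with ∈-++⁻ (rixᵗ l) x∈
... | inj₁ x∈l = ∈-++⁺ˡ (∈-singletonᶜ⁺ l x∈l)
... | inj₂ (here refl) = ∈-++⁺ʳ (cyclesᵗ (Φᵗ l)) (here refl)
∈-singletonᶜ⁺ (peak l y r) x∈ = ∈-++⁺ˡ (∈-singletonᶜ⁺ r x∈)

-- Cycles from `desc` and `peak` contain a nonempty subtree besides their maximum, so only `one` and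
-- `asc` can contribute singletons.
∈-singletonᶜ⁻ : ∀ {x} t → [ x ] ∈ cyclesᵗ (Φᵗ t) → x ∈ rixᵗ t
∈-singletonᶜ⁻ (one y) (here refl) = here refl
∈-singletonᶜ⁻ (asc l y) x∈ with ∈-++⁻ (cyclesᵗ (Φᵗ l)) x∈
... | inj₁ x∈l = ∈-++⁺ˡ (∈-singletonᶜ⁻ l x∈l)
... | inj₂ (here refl) = ∈-++⁺ʳ (rixᵗ l) (here refl)
∈-singletonᶜ⁻ (desc y r) (here eq) with nonempty (mirror r)
... | _ , _ , eq′ rewrite eq′ with eq
...   | ()
∈-singletonᶜ⁻ (peak l y r) x∈ with ∈-++⁻ (cyclesᵗ (Φᵗ r)) x∈
... | inj₁ x∈r = ∈-singletonᶜ⁻ r x∈r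
... | inj₂ (here eq) with nonempty (mirror l)
...   | _ , _ , eq′ rewrite eq′ with eq
...     | ()

-- Permutations given by disjoint cycles

nextAux-∉ : ∀ {h x} w → x ∉ w → nextAux h x w ≡ nothing
nextAux-∉ [] _ = refl
nextAux-∉ {x = x} (a ∷ []) x∉ rewrite ==-false {a} {x} (λ a≡x → x∉ (here (sym a≡x))) = refl
nextAux-∉ (a ∷ b ∷ w) x∉ =
  trans (if-false (==-false λ a≡x → x∉ (here (sym a≡x)))) (nextAux-∉ (b ∷ w) (x∉ ∘ there))

-- The default `h` is the wrap-around from the last letter of a cycle to its first.
nextAux-++ : ∀ {h x} p q → x ∉ p → nextAux h x (p ++ x ∷ q) ≡ just (fromMaybe h (head q))
nextAux-++ {x = x} [] [] _ rewrite ==-refl x = refl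
nextAux-++ {x = x} [] (y ∷ q) _ rewrite ==-refl x = refl
nextAux-++ {x = x} (a ∷ []) q x∉ rewrite ==-false {a} {x} (λ a≡x → x∉ (here (sym a≡x))) =
  nextAux-++ [] q λ ()
nextAux-++ (a ∷ b ∷ p) q x∉ =
  trans (if-false (==-false λ a≡x → x∉ (here (sym a≡x)))) (nextAux-++ (b ∷ p) q (x∉ ∘ there))

nextIn-∉ : ∀ {x} c → x ∉ c → nextIn x c ≡ nothing
nextIn-∉ [] _ = refl
nextIn-∉ (h ∷ c) = nextAux-∉ (h ∷ c)

concat-↭ : {cs ds : List (List ℕ)} → cs ↭ ds → concat cs ↭ concat ds
concat-↭ ↭.refl = ↭-refl
concat-↭ (prep c p) = ++⁺ˡ c (concat-↭ p)
concat-↭ (swap {ys = ds} c d p) = ↭-trans (++⁺ˡ c (++⁺ˡ d (concat-↭ p))) (shifts c d)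
concat-↭ (↭.trans p q) = ↭-trans (concat-↭ p) (concat-↭ q)

imageCycles-skip : ∀ {x c} cs → x ∉ c → imageCycles (c ∷ cs) x ≡ imageCycles cs x
imageCycles-skip {c = c} cs x∉ rewrite nextIn-∉ c x∉ = refl

imageCycles-∷ : ∀ c {cs ds x} → imageCycles cs x ≡ imageCycles ds x →
  imageCycles (c ∷ cs) x ≡ imageCycles (c ∷ ds) x
imageCycles-∷ c {x = x} eq with nextIn x c
... | just _  = refl
... | nothing = eq

-- Lookup takes the first cycle containing `x`; disjointness leaves at most one such cycle, so the
-- order is irrelevant.
imageCycles-↭ : ∀ {cs ds} x → cs ↭ ds → Unique (concat cs) → imageCycles cs x ≡ imageCycles ds x
imageCycles-↭ x ↭.refl _ = refl
imageCycles-↭ x (prep c p) u = imageCycles-∷ c (imageCycles-↭ x p (proj₁ (proj₂ (unique-++⁻ c u))))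
imageCycles-↭ x (swap {xs = cs} {ds} c d p) u with unique-++⁻ c u
... | _ , u′ , disj with imageCycles-↭ x p (proj₁ (proj₂ (unique-++⁻ d u′))) | x ∈? c
...   | ih | yes x∈c =
  trans (imageCycles-∷ c (trans (imageCycles-skip cs x∉d) ih)) (sym (imageCycles-skip (c ∷ ds) x∉d))
  where
  x∉d : x ∉ d
  x∉d x∈d = disj (x∈c , ∈-++⁺ˡ x∈d)
...   | ih | no x∉c =
  trans (imageCycles-skip (d ∷ cs) x∉c) (imageCycles-∷ d (trans ih (sym (imageCycles-skip ds x∉c))))
imageCycles-↭ x (↭.trans p q) u =
  trans (imageCycles-↭ x p u) (imageCycles-↭ x q (unique-resp-↭ (concat-↭ p) u))

imageCycles-∈ : ∀ {cs h c x} p {q} → Unique (concat cs) → (h ∷ c) ∈ cs → h ∷ c ≡ p ++ x ∷ q →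
  imageCycles cs x ≡ fromMaybe h (head q)
imageCycles-∈ {.(h ∷ c) ∷ cs} {h} {c} {x} p {q} u (here refl) eq = found
  where
  x∉p : x ∉ p
  x∉p x∈p = proj₂ (proj₂ (unique-++⁻ p (subst Unique eq (proj₁ (unique-++⁻ (h ∷ c) u))))) (x∈p , here refl)
  found : imageCycles ((h ∷ c) ∷ cs) x ≡ fromMaybe h (head q)
  found rewrite trans (cong (nextAux h x) eq) (nextAux-++ {h} p q x∉p) = refl
imageCycles-∈ {d ∷ cs} {h} {c} {x} p u (there c∈cs) eq
  with unique-++⁻ d u
... | _ , u′ , disj =
  trans (imageCycles-skip cs λ x∈d → disj (x∈d , ∈-concat⁺′ (subst (x ∈_) (sym eq) (∈-insert p)) c∈cs))
    (imageCycles-∈ p u′ c∈cs eq)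

∈-range⁻ : ∀ {n x} → x ∈ range n → ∃ λ k → x ≡ suc k × k < n
∈-range⁻ x∈ with ∈-map⁻ suc x∈
... | k , k∈ , eq = k , eq , ∈-upTo⁻ k∈

∈-range⁺ : ∀ {n k} → k < n → suc k ∈ range n
∈-range⁺ k<n = ∈-map⁺ suc (∈-upTo⁺ k<n)

range-unique : ∀ n → Unique (range n)
range-unique n = Unique.map⁺ suc-injective (Unique.upTo⁺ n)

range-suc : ∀ n → range (suc n) ≡ range n ++ [ suc n ]
range-suc n = trans (cong (map suc) (sym (upTo-∷ʳ n))) (map-++ suc (upTo n) [ n ])

length-range : ∀ n → length (range n) ≡ n
length-range n = trans (length-map suc (upTo n)) (length-upTo n)

length-fromCycles : ∀ n cs → length (fromCycles n cs) ≡ n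
length-fromCycles n cs = trans (length-map (imageCycles cs) (range n)) (length-range n)

at-applyUpTo : ∀ (f : ℕ → ℕ) {n k} → k < n → at (applyUpTo f n) (suc k) ≡ just (f k)
at-applyUpTo f {suc n} {zero} _ = refl
at-applyUpTo f {suc n} {suc k} (s≤s k<n) = at-applyUpTo (f ∘ suc) k<n

app-fromCycles : ∀ {n x} cs → x ∈ range n → app (fromCycles n cs) x ≡ imageCycles cs x
app-fromCycles {n} cs x∈ with ∈-range⁻ x∈
... | k , refl , k<n
  rewrite map-upTo suc n | map-applyUpTo suc (imageCycles cs) n | at-applyUpTo (imageCycles cs ∘ suc) k<n = refl

length-concat-∈ : ∀ {c : List ℕ} {cs} → c ∈ cs → length c ≤ length (concat cs)
length-concat-∈ {c} {cs = .c ∷ cs} (here refl) =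
  ≤-trans (m≤m+n (length c) (length (concat cs))) (≤-reflexive (sym (length-++ c)))
length-concat-∈ {cs = d ∷ cs} (there c∈) =
  ≤-trans (length-concat-∈ c∈)
    (≤-trans (m≤n+m (length (concat cs)) (length d)) (≤-reflexive (sym (length-++ d))))

-- Recovering cycles by iterating the permutation

piece : List ℕ → ℕ → List ℕ
piece τ m = if maxL (cycleOf τ m) == m then cycleOf τ m else []

module _ {n} (cs : List (List ℕ)) (perm : concat cs ↭ range n) where

  private
    τ : List ℕ
    τ = fromCycles n cs

  concat-unique : Unique (concat cs)
  concat-unique = unique-resp-↭ (↭-sym perm) (range-unique n)

  module _ {h c} (c∈ : (h ∷ c) ∈ cs) where

    cycle-unique : Unique (h ∷ c)
    cycle-unique = go c∈ concat-unique
      where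
      go : ∀ {ds} → (h ∷ c) ∈ ds → Unique (concat ds) → Unique (h ∷ c)
      go (here refl) u = proj₁ (unique-++⁻ (h ∷ c) u)
      go {d ∷ _} (there c∈) u = go c∈ (proj₁ (proj₂ (unique-++⁻ d u)))

    app-next : ∀ {x} p {q} → h ∷ c ≡ p ++ x ∷ q → app τ x ≡ fromMaybe h (head q)
    app-next {x} p eq =
      trans (app-fromCycles cs (∈-resp-↭ perm (∈-concat⁺′ (subst (x ∈_) (sym eq) (∈-insert p)) c∈)))
        (imageCycles-∈ p concat-unique c∈ eq)

    later≢head : ∀ {x y} p {q} → h ∷ c ≡ p ++ x ∷ q → y ∈ q → y ≢ h
    later≢head [] refl y∈q refl = Unique.Unique[x∷xs]⇒x∉xs cycle-unique y∈q
    later≢head (_ ∷ p) refl y∈q refl = Unique.Unique[x∷xs]⇒x∉xs cycle-unique (∈-++⁺ʳ p (there y∈q))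

    length-cycle : length c < n
    length-cycle =
      ≤-trans (length-concat-∈ c∈) (≤-reflexive (trans (↭-length perm) (length-range n)))

    -- The split `p`, `x`, `q` marks the progress around the cycle. Running out of fuel is harmless:
    -- by then `q` is empty.
    orbit-head : ∀ {x} k p q → h ∷ c ≡ p ++ x ∷ q → length q ≤ k → orbitAux τ k h (app τ x) ≡ q
    orbit-head zero p [] eq _ = refl
    orbit-head (suc k) p [] eq _ rewrite app-next p eq | ==-refl h = refl
    orbit-head {x} (suc k) p (y ∷ q) eq (s≤s len)
      rewrite app-next p eq | ==-false (later≢head p eq (here refl)) =
      cong (y ∷_) (orbit-head k (p ++ [ x ]) q (trans eq (sym (++-assoc p [ x ] (y ∷ q)))) len)

    -- Started at `m`, the walk meets `h` before it returns to `m`, because `m` does not recur in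
    -- the remainder `q`. The fuel bound is strict: one step more than `q` is needed to emit `h`.
    orbit-∋head : ∀ {x m} k p q → h ∷ c ≡ p ++ x ∷ q → length q < k → m ∉ q → m ≢ h →
      h ∈ orbitAux τ k m (app τ x)
    orbit-∋head (suc k) p [] eq _ _ m≢h rewrite app-next p eq | ==-false (m≢h ∘ sym) = here refl
    orbit-∋head {x} {m} (suc k) p (y ∷ q) eq (s≤s len) m∉ m≢h
      rewrite app-next p eq | ==-false {y} {m} (λ y≡m → m∉ (here (sym y≡m))) =
      there (orbit-∋head k (p ++ [ x ]) q (trans eq (sym (++-assoc p [ x ] (y ∷ q)))) len (m∉ ∘ there) m≢h)

    cycleOf-head : cycleOf τ h ≡ h ∷ c
    cycleOf-head = cong (h ∷_) (orbit-head (length τ) [] c refl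
      (≤-trans (<⇒≤ length-cycle) (≤-reflexive (sym (length-fromCycles n cs)))))

    cycleOf-∋head : ∀ {m} → m ∈ c → h ∈ cycleOf τ m
    cycleOf-∋head {m} m∈c with ∈-∃++ m∈c
    ... | p , q , refl = there (orbit-∋head (length τ) (h ∷ p) q refl
      (≤-trans (≤-trans (s≤s (≤-trans (≤-trans (n≤1+n _) (m≤n+m _ (length p))) (≤-reflexive (sym (length-++ p)))))
        length-cycle) (≤-reflexive (sym (length-fromCycles n cs))))
      (λ m∈q → Unique.Unique[x∷xs]⇒x∉xs (proj₁ (proj₂ (unique-++⁻ (h ∷ p) cycle-unique))) m∈q)
      (later≢head [] refl m∈c))

    app-fixed⇒singleton : ∀ {x} → x ∈ h ∷ c → app τ x ≡ x → h ∷ c ≡ [ x ]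
    app-fixed⇒singleton x∈ fixed with ∈-∃++ x∈
    ... | p , y ∷ q , eq = contradiction (here (trans (sym fixed) (app-next p eq)))
      (Unique.Unique[x∷xs]⇒x∉xs (proj₁ (proj₂ (unique-++⁻ p (subst Unique eq cycle-unique)))))
    ... | [] , [] , eq = eq
    ... | _ ∷ p , [] , eq = contradiction (trans (sym fixed) (app-next (_ ∷ p) eq)) (last≢ p eq)
      where
      last≢ : ∀ {a x} p → h ∷ c ≡ a ∷ p ++ [ x ] → x ≢ h
      last≢ p refl refl = Unique.Unique[x∷xs]⇒x∉xs cycle-unique (∈-insert p)

    piece-head : All (_< h) c → piece τ h ≡ h ∷ c
    piece-head c<h = trans (if-true (trans (cong (_== h) max≡h) (==-refl h))) cycleOf-head
      where
      max≡h : maxL (cycleOf τ h) ≡ h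
      max≡h = trans (cong maxL cycleOf-head) (maxL-≡ (here refl) (≤-refl ∷ All.map <⇒≤ c<h))

    -- The cycle read from `m` still contains the larger `h`, so `m` fails the maximality test.
    piece-tail : ∀ {m} → m ∈ c → m < h → piece τ m ≡ []
    piece-tail {m} m∈c m<h = if-false (==-false λ eq →
      <⇒≱ m<h (≤-trans (∈⇒≤maxL (cycleOf-∋head m∈c)) (≤-reflexive eq)))

-- o ∘ o⁻¹

rootᵗ : Tree → ℕ
rootᵗ (one x)      = x
rootᵗ (asc l x)    = x
rootᵗ (desc x r)   = x
rootᵗ (peak l x r) = x

rootᵗ-∈ : ∀ t → rootᵗ t ∈ flat t
rootᵗ-∈ (one x) = here refl
rootᵗ-∈ (asc l x) = ∈-insert (flat l)
rootᵗ-∈ (desc x r) = here refl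
rootᵗ-∈ (peak l x r) = ∈-insert (flat l)

decreasing-root : ∀ {b c t} → rootᵗ t < c → Decreasing b t → Decreasing c t
decreasing-root x<c (one _) = one x<c
decreasing-root x<c (asc l _) = asc l x<c
decreasing-root x<c (desc _ r) = desc x<c r
decreasing-root x<c (peak l _ r d) = peak l x<c r d

∈-cyclesᵗ : ∀ {c} t → c ∈ cyclesᵗ t → ∀ {x} → x ∈ c → x ∈ flat t
∈-cyclesᵗ t c∈ x∈c = subst (_ ∈_) (concat-cyclesᵗ t) (∈-concat⁺′ x∈c c∈)

cyclesᵗ-max : ∀ {b t c} → Decreasing b t → c ∈ cyclesᵗ t → ∃₂ λ h c′ → c ≡ h ∷ c′ × All (_< h) c′
cyclesᵗ-max (one _) (here refl) = _ , [] , refl , []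
cyclesᵗ-max (asc {l} dl _) c∈ with ∈-++⁻ (cyclesᵗ l) c∈
... | inj₁ c∈l = cyclesᵗ-max dl c∈l
... | inj₂ (here refl) = _ , [] , refl , []
cyclesᵗ-max (desc _ dr) (here refl) = _ , _ , refl , flat<b dr
cyclesᵗ-max (peak {l} dl _ dr _) c∈ with ∈-++⁻ (cyclesᵗ l) c∈
... | inj₁ c∈l = cyclesᵗ-max dl c∈l
... | inj₂ (here refl) = _ , _ , refl , flat<b dr

concat-range-suc : ∀ k (f : ℕ → List ℕ) → concat (map f (range (suc k))) ≡ concat (map f (range k)) ++ f (suc k)
concat-range-suc k f = begin
  concat (map f (range (suc k)))                    ≡⟨ cong (concat ∘ map f) (range-suc k) ⟩
  concat (map f (range k ++ [ suc k ]))             ≡⟨ cong concat (map-++ f (range k) [ suc k ]) ⟩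
  concat (map f (range k) ++ [ f (suc k) ])         ≡⟨ concat-++ (map f (range k)) [ f (suc k) ] ⟨
  concat (map f (range k)) ++ f (suc k) ++ []       ≡⟨ cong (concat (map f (range k)) ++_) (++-identityʳ _) ⟩
  concat (map f (range k)) ++ f (suc k)             ∎
  where open ≡-Reasoning

concat-range-[] : ∀ k {f : ℕ → List ℕ} → (∀ {m} → m < k → f (suc m) ≡ []) → concat (map f (range k)) ≡ []
concat-range-[] zero _ = refl
concat-range-[] (suc k) {f} e =
  trans (concat-range-suc k f) (cong₂ _++_ (concat-range-[] k (e ∘ m≤n⇒m≤1+n)) (e ≤-refl))

-- Induction peels off the top value `suc k`: if it is not the root it contributes nothing, and if
-- it is, it contributes the last cycle and leaves the left subtree, when there is one. Abstracting
-- `piece` to `f` keeps the permutation fixed while the tree shrinks; `0 ∉ flat t` is assumed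
-- because `range` starts at `1`.
concat-range : ∀ k t {f : ℕ → List ℕ} → Decreasing (suc k) t → 0 ∉ flat t →
  (∀ {h c} → (h ∷ c) ∈ cyclesᵗ t → f h ≡ h ∷ c) →
  (∀ {m} → m < k → (∀ c → (suc m ∷ c) ∉ cyclesᵗ t) → f (suc m) ≡ []) →
  concat (map f (range k)) ≡ flat t
concat-range zero t dec 0∉ _ _ with rootᵗ t | rootᵗ-∈ t | All.lookup (flat<b dec) (rootᵗ-∈ t)
... | zero | 0∈ | _ = contradiction 0∈ 0∉
... | suc _ | _ | s≤s ()
concat-range (suc k) t {f} dec 0∉ heads others
  with rootᵗ t ≟ suc k
... | no root≢ =
  trans (trans (concat-range-suc k f) (cong (concat (map f (range k)) ++_) (others ≤-refl λ c c∈ →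
           <-lookup (flat<b (decreasing-root root< dec)) (∈-cyclesᵗ t c∈ (here refl)) refl)))
    (trans (++-identityʳ _)
      (concat-range k t (decreasing-root root< dec) 0∉ heads λ m<k → others (m≤n⇒m≤1+n m<k)))
  where
  root< : rootᵗ t < suc k
  root< = ≤∧≢⇒< (≤-pred (All.lookup (flat<b dec) (rootᵗ-∈ t))) root≢
... | yes root≡ = trans (concat-range-suc k f) (atRoot t dec root≡ 0∉ heads others)
  where
  single : ∀ v → (∀ {h : ℕ} {c : List ℕ} → (h ∷ c) ∈ [ suc k ∷ v ] → f h ≡ h ∷ c) →
    (∀ {m} → m < suc k → (∀ (c : List ℕ) → (suc m ∷ c) ∉ [ suc k ∷ v ]) → f (suc m) ≡ []) →
    concat (map f (range k)) ++ f (suc k) ≡ suc k ∷ v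
  single v heads others =
    cong₂ _++_ (concat-range-[] k λ m<k → others (m≤n⇒m≤1+n m<k) λ { _ (here refl) → 1+n≰n m<k })
        (heads (here refl))
  snoc : ∀ l v → Decreasing (suc k) l → 0 ∉ flat l →
    (∀ {h : ℕ} {c : List ℕ} → (h ∷ c) ∈ cyclesᵗ l ++ [ suc k ∷ v ] → f h ≡ h ∷ c) →
    (∀ {m} → m < suc k → (∀ (c : List ℕ) → (suc m ∷ c) ∉ cyclesᵗ l ++ [ suc k ∷ v ]) → f (suc m) ≡ []) →
    concat (map f (range k)) ++ f (suc k) ≡ flat l ++ suc k ∷ v
  snoc l v dl 0∉ heads others =
    cong₂ _++_
        (concat-range k l dl 0∉ (heads ∘ ∈-++⁺ˡ) λ m<k m∉ → others (m≤n⇒m≤1+n m<k)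
          λ c c∈ → [ m∉ c , (λ { (here refl) → 1+n≰n m<k }) ]′ (∈-++⁻ (cyclesᵗ l) c∈))
        (heads (∈-++⁺ʳ (cyclesᵗ l) (here refl)))
  atRoot : ∀ t → Decreasing (suc (suc k)) t → rootᵗ t ≡ suc k → 0 ∉ flat t →
    (∀ {h : ℕ} {c : List ℕ} → (h ∷ c) ∈ cyclesᵗ t → f h ≡ h ∷ c) →
    (∀ {m} → m < suc k → (∀ (c : List ℕ) → (suc m ∷ c) ∉ cyclesᵗ t) → f (suc m) ≡ []) →
    concat (map f (range k)) ++ f (suc k) ≡ flat t
  atRoot (one _) _ refl _ = single []
  atRoot (asc l _) (asc dl _) refl 0∉ = snoc l [] dl (0∉ ∘ ∈-++⁺ˡ)
  atRoot (desc _ r) _ refl _ = single (flat r)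
  atRoot (peak l _ r) (peak dl _ _ _) refl 0∉ = snoc l (flat r) dl (0∉ ∘ ∈-++⁺ˡ)

foataInv-perm : ∀ {n t} → Decreasing (suc n) t → flat t ↭ range n → foataInv (flat t) ≡ fromCycles n (cyclesᵗ t)
foataInv-perm {n} {t} dec perm =
  trans (foataInv-flat dec) (cong (λ k → fromCycles k (cyclesᵗ t)) (trans (↭-length perm) (length-range n)))

foata-foataInv : ∀ {n t} → Decreasing (suc n) t → flat t ↭ range n → foata (foataInv (flat t)) ≡ flat t
foata-foataInv {n} {t} dec perm = begin
  foata (foataInv (flat t))                           ≡⟨ cong foata (foataInv-perm dec perm) ⟩
  foata τ ≡⟨ cong (concat ∘ map (piece τ) ∘ range) (length-fromCycles n (cyclesᵗ t)) ⟩
  concat (map (piece τ) (range n))                ≡⟨ concat-range n t dec 0∉ heads others ⟩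
  flat t                                              ∎
  where
  open ≡-Reasoning
  τ = fromCycles n (cyclesᵗ t)
  perm′ : concat (cyclesᵗ t) ↭ range n
  perm′ = ↭-trans (↭-reflexive (concat-cyclesᵗ t)) perm
  0∉ : 0 ∉ flat t
  0∉ 0∈ with ∈-range⁻ (∈-resp-↭ perm 0∈)
  ... | _ , () , _
  heads : ∀ {h c} → (h ∷ c) ∈ cyclesᵗ t → piece τ h ≡ h ∷ c
  heads c∈ with cyclesᵗ-max dec c∈
  ... | _ , _ , refl , c<h = piece-head (cyclesᵗ t) perm′ c∈ c<h
  others : ∀ {m} → m < n → (∀ (c : List ℕ) → (suc m ∷ c) ∉ cyclesᵗ t) → piece τ (suc m) ≡ []
  others {m} m<n m∉ with ∈-concat⁻′ (cyclesᵗ t) (∈-resp-↭ (↭-sym perm′) (∈-range⁺ m<n))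
  ... | d , m∈d , d∈ with cyclesᵗ-max dec d∈
  ...   | h , c , refl , c<h with m∈d
  ...     | here refl = contradiction d∈ (m∉ c)
  ...     | there m∈c = piece-tail (cyclesᵗ t) perm′ d∈ m∈c (All.lookup c<h m∈c)

-- Part (a) on trees

~-sym : ∀ {t u} → t ~ u → u ~ t
~-sym {t} (by p refl) = by p (hopᵗ-involutive p t)

~-trans : ∀ {t u v} → t ~ u → u ~ v → t ~ v
~-trans {t} (by p refl) (by q refl) = by _ (sym (hopᵗ-∘ q p t))

~-mirror : ∀ {t u} → t ~ u → mirror t ~ mirror u
~-mirror {t} (by p refl) = by p (hopᵗ-mirror p t)

-- The detour runs from `Φᵗ t` to `mirror t`, then to `mirror u` and `Φᵗ u`.
Φᵗ-~ : ∀ {b t u} → Decreasing b t → t ~ u → Φᵗ t ~ Φᵗ u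
Φᵗ-~ dt t~u@(by p refl) =
  ~-trans (~-sym (Φᵗ-mirror dt)) (~-trans (~-mirror t~u) (Φᵗ-mirror (hopᵗ-decreasing p dt)))

-- Since `v` is `Φᵗ (Ψᵗ v)`, it is equivalent to `mirror (Ψᵗ v)`; this links the mirrors of `t` and
-- `Ψᵗ v`, and reflecting once more removes them.
Ψᵗ-~ : ∀ {b t v} → Decreasing b t → Φᵗ t ~ v → t ~ Ψᵗ v
Ψᵗ-~ {t = t} {v} dt Φt~v@(by p refl) =
  subst₂ _~_ (mirror-involutive t) (mirror-involutive (Ψᵗ v))
    (~-mirror (~-trans (Φᵗ-mirror dt) (~-trans Φt~v (~-sym mirrorΨv~v))))
  where
  mirrorΨv~v : mirror (Ψᵗ v) ~ v
  mirrorΨv~v = subst (mirror (Ψᵗ v) ~_) (Φᵗ-Ψᵗ v)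
    (Φᵗ-mirror (Ψᵗ-decreasing (hopᵗ-decreasing p (Φᵗ-decreasing dt))))

-- From trees back to permutations

record TreeOf (n : ℕ) (t : Tree) : Set where
  constructor treeOf
  field
    decreasing  : Decreasing (suc n) t
    permutation : flat t ↭ range n

open TreeOf

module _ {n t} (T : TreeOf n t) where

  hopᵗ-treeOf : ∀ p → TreeOf n (hopᵗ p t)
  hopᵗ-treeOf p = treeOf (hopᵗ-decreasing p (decreasing T)) (↭-trans (hopᵗ-↭ p t) (permutation T))

  Φᵗ-treeOf : TreeOf n (Φᵗ t)
  Φᵗ-treeOf = treeOf (Φᵗ-decreasing (decreasing T)) (↭-trans (Φᵗ-↭ t) (permutation T))

  Ψᵗ-treeOf : TreeOf n (Ψᵗ t)
  Ψᵗ-treeOf = treeOf (Ψᵗ-decreasing (decreasing T)) (↭-trans (Ψᵗ-↭ t) (permutation T))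

  cyc-hop-flat : ∀ x → cyc-hop x (foataInv (flat t)) ≡ foataInv (flat (hopᵗ (_== x) t))
  cyc-hop-flat x = cong foataInv
    (trans (cong (hop x) (foata-foataInv (decreasing T) (permutation T))) (hop-flat x t (decreasing T)))

  cyclesᵗ-perm : concat (cyclesᵗ t) ↭ range n
  cyclesᵗ-perm = ↭-trans (↭-reflexive (concat-cyclesᵗ t)) (permutation T)

module _ {n t} (T : TreeOf n t) where

  Φ-flat : Φ (flat t) ≡ foataInv (flat (Φᵗ t))
  Φ-flat = begin
    fromCycles (length (flat t)) (PhiCycles (flat t))
      ≡⟨ cong (λ k → fromCycles k (PhiCycles (flat t))) (trans (↭-length (permutation T)) (length-range n)) ⟩
    fromCycles n (PhiCycles (flat t))
      ≡⟨ map-cong (λ x → sym (imageCycles-↭ x (↭-sym (PhiCycles-flat (decreasing T))) unique)) (range n) ⟩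
    fromCycles n (cyclesᵗ (Φᵗ t))
      ≡⟨ foataInv-perm (decreasing (Φᵗ-treeOf T)) (permutation (Φᵗ-treeOf T)) ⟨
    foataInv (flat (Φᵗ t)) ∎
    where
    open ≡-Reasoning
    unique : Unique (concat (cyclesᵗ (Φᵗ t)))
    unique = concat-unique (cyclesᵗ (Φᵗ t)) (cyclesᵗ-perm (Φᵗ-treeOf T))

  foata-Φ : foata (Φ (flat t)) ≡ flat (Φᵗ t)
  foata-Φ = trans (cong foata Φ-flat)
    (foata-foataInv (decreasing (Φᵗ-treeOf T)) (permutation (Φᵗ-treeOf T)))

-- Hopping over subsets

χ : ∀ {m} → ℕ → Subset m → ℕ → Bool
χ k []ᵛ           y = false
χ k (true ∷ᵛ bs)  y = χ (suc k) bs y xor (y == k)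
χ k (false ∷ᵛ bs) y = χ (suc k) bs y

χ-< : ∀ {m} k (S : Subset m) {y} → y < k → χ k S y ≡ false
χ-< k []ᵛ _ = refl
χ-< k (true ∷ᵛ bs) y<k rewrite χ-< (suc k) bs (m<n⇒m<1+n y<k) = ==-false (<⇒≢ y<k)
χ-< k (false ∷ᵛ bs) y<k = χ-< (suc k) bs (m<n⇒m<1+n y<k)

-- The letters hopped in turn are distinct, so the xor in `χ` never cancels: by `χ-<` the later
-- positions are silent at `k`.
χ-surjective : ∀ (p : ℕ → Bool) k m → ∃ λ (S : Subset m) → ∀ {y} → k ≤ y → y < k + m → χ k S y ≡ p y
χ-surjective p k zero = []ᵛ , λ k≤y y<k → contradiction (≤-trans y<k (≤-reflexive (+-identityʳ k))) (≤⇒≯ k≤y)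
χ-surjective p k (suc m) with χ-surjective p (suc k) m
... | S , eq = p k ∷ᵛ S , λ k≤y y< → [ (λ k<y → above k<y y<) , (λ { refl → at-k }) ]′ (m≤n⇒m<n∨m≡n k≤y)
  where
  above : ∀ {y} → k < y → y < k + suc m → χ k (p k ∷ᵛ S) y ≡ p y
  above {y} k<y y< with p k | eq k<y (subst (y <_) (+-suc k m) y<)
  ... | true  | eq′ rewrite eq′ | ==-false (<⇒≢ k<y ∘ sym) = xor-identityʳ (p y)
  ... | false | eq′ = eq′
  at-k : χ k (p k ∷ᵛ S) k ≡ p k
  at-k with p k
  ... | true rewrite χ-< (suc k) S (n<1+n k) = ==-refl k
  ... | false = χ-< (suc k) S (n<1+n k)

~⇒χ : ∀ {n t u} → TreeOf n t → t ~ u → ∃ λ (S : Subset n) → hopᵗ (χ 1 S) t ≡ u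
~⇒χ {n} {t} T (by p refl) with χ-surjective p 1 n
... | S , eq = S , hopᵗ-cong t agree
  where
  agree : ∀ {y} → y ∈ flat t → χ 1 S y ≡ p y
  agree y∈ with ∈-range⁻ (∈-resp-↭ (permutation T) y∈)
  ... | k , refl , k<n = eq (s≤s z≤n) (s≤s k<n)

-- The encoding `e` is abstract so that one induction serves both one-line words and permutations
-- read through `foataInv`.
applySubset-hopᵗ : ∀ {n m} {f : ℕ → List ℕ → List ℕ} {e : Tree → List ℕ} →
  (∀ {t} → TreeOf n t → ∀ x → f x (e t) ≡ e (hopᵗ (_== x) t)) →
  ∀ k (S : Subset m) {t} → TreeOf n t → applySubset f k S (e t) ≡ e (hopᵗ (χ k S) t)
applySubset-hopᵗ {e = e} f-e k []ᵛ {t} T = cong e (sym (hopᵗ-false t))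
applySubset-hopᵗ {f = f} {e} f-e k (true ∷ᵛ S) {t} T = begin
  applySubset f (suc k) S (f k (e t))                ≡⟨ cong (applySubset f (suc k) S) (f-e T k) ⟩
  applySubset f (suc k) S (e (hopᵗ (_== k) t))       ≡⟨ applySubset-hopᵗ f-e (suc k) S (hopᵗ-treeOf T (_== k)) ⟩
  e (hopᵗ (χ (suc k) S) (hopᵗ (_== k) t))            ≡⟨ cong e (hopᵗ-∘ (χ (suc k) S) (_== k) t) ⟩
  e (hopᵗ (χ k (true ∷ᵛ S)) t)                       ∎
  where open ≡-Reasoning
applySubset-hopᵗ f-e k (false ∷ᵛ S) T = applySubset-hopᵗ f-e (suc k) S T

applySubset-hop : ∀ {n m} k (S : Subset m) {t} → TreeOf n t → applySubset hop k S (flat t) ≡ flat (hopᵗ (χ k S) t)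
applySubset-hop = applySubset-hopᵗ {f = hop} {e = flat} λ {t} T x → hop-flat x t (decreasing T)

applySubset-cyc-hop : ∀ {n m} k (S : Subset m) {t} → TreeOf n t →
  applySubset cyc-hop k S (foataInv (flat t)) ≡ foataInv (flat (hopᵗ (χ k S) t))
applySubset-cyc-hop = applySubset-hopᵗ {f = cyc-hop} {e = λ t → foataInv (flat t)} cyc-hop-flat

Φ-VHOrbit : ∀ {n t} → TreeOf n t → ImageEq Φ (VHOrbit n (flat t)) (CVHOrbit n (Φ (flat t)))
Φ-VHOrbit {n} {t} T = into , onto
  where
  into : ∀ σ → VHOrbit n (flat t) σ → CVHOrbit n (Φ (flat t)) (Φ σ)
  into σ (S , refl) with ~⇒χ (Φᵗ-treeOf T) (Φᵗ-~ (decreasing T) (by (χ 1 S) refl))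
  ... | S′ , eq = S′ , (begin
    applySubset cyc-hop 1 S′ (Φ (flat t))              ≡⟨ cong (applySubset cyc-hop 1 S′) (Φ-flat T) ⟩
    applySubset cyc-hop 1 S′ (foataInv (flat (Φᵗ t)))  ≡⟨ applySubset-cyc-hop 1 S′ (Φᵗ-treeOf T) ⟩
    foataInv (flat (hopᵗ (χ 1 S′) (Φᵗ t)))             ≡⟨ cong (foataInv ∘ flat) eq ⟩
    foataInv (flat (Φᵗ (hopᵗ (χ 1 S) t)))              ≡⟨ Φ-flat (hopᵗ-treeOf T (χ 1 S)) ⟨
    Φ (flat (hopᵗ (χ 1 S) t))                          ≡⟨ cong Φ (applySubset-hop 1 S T) ⟨
    Φ (applySubset hop 1 S (flat t))                   ∎)
    where open ≡-Reasoning
  onto : ∀ τ → CVHOrbit n (Φ (flat t)) τ → ∃ λ σ → VHOrbit n (flat t) σ × Φ σ ≡ τ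
  -- `Ψᵗ v` is a preimage of the hopped tree `v`, and `Ψᵗ-~` places it in the orbit of `t`.
  onto τ (S , refl) with ~⇒χ T (Ψᵗ-~ (decreasing T) (by (χ 1 S) refl))
  ... | S′ , eq = flat (Ψᵗ v) , (S′ , trans (applySubset-hop 1 S′ T) (cong flat eq)) , (begin
    Φ (flat (Ψᵗ v))                                    ≡⟨ Φ-flat (Ψᵗ-treeOf V) ⟩
    foataInv (flat (Φᵗ (Ψᵗ v)))                        ≡⟨ cong (foataInv ∘ flat) (Φᵗ-Ψᵗ v) ⟩
    foataInv (flat v)                                  ≡⟨ applySubset-cyc-hop 1 S (Φᵗ-treeOf T) ⟨
    applySubset cyc-hop 1 S (foataInv (flat (Φᵗ t)))   ≡⟨ cong (applySubset cyc-hop 1 S) (Φ-flat T) ⟨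
    applySubset cyc-hop 1 S (Φ (flat t))               ∎)
    where
    open ≡-Reasoning
    v : Tree
    v = hopᵗ (χ 1 S) (Φᵗ t)
    V : TreeOf n v
    V = hopᵗ-treeOf (Φᵗ-treeOf T) (χ 1 S)

-- Restricted hops

∈ᵇ-true : ∀ {x w} → x ∈ w → (x ∈ᵇ w) ≡ true
∈ᵇ-true {x} (here refl) rewrite ==-refl x = refl
∈ᵇ-true {x} {a ∷ _} (there x∈) rewrite ∈ᵇ-true x∈ = ∨-zeroʳ (a == x)

∈ᵇ-false : ∀ {x} w → x ∉ w → (x ∈ᵇ w) ≡ false
∈ᵇ-false [] _ = refl
∈ᵇ-false {x} (a ∷ w) x∉ rewrite ==-false {a} {x} (λ a≡x → x∉ (here (sym a≡x))) = ∈ᵇ-false w (x∉ ∘ there)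

hop^ᵗ : ℕ → Tree → Tree
hop^ᵗ x t = if (x ∈ᵇ rixᵗ t) ∨ (β₁ᵗ t == x) then t else hopᵗ (_== x) t

hop^-flat : ∀ {b} x t → Decreasing b t → hop^ x (flat t) ≡ flat (hop^ᵗ x t)
hop^-flat x t dec rewrite rixPts-flat dec | beta1-flat dec with (x ∈ᵇ rixᵗ t) ∨ (β₁ᵗ t == x)
... | true  = refl
... | false = hop-flat x t dec

hop^ᵗ-treeOf : ∀ {n t} x → TreeOf n t → TreeOf n (hop^ᵗ x t)
hop^ᵗ-treeOf {t = t} x T with (x ∈ᵇ rixᵗ t) ∨ (β₁ᵗ t == x)
... | true  = T
... | false = hopᵗ-treeOf T (_== x)

module _ {n t} (T : TreeOf n t) {x} (x∈ : x ∈ range n) where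

  private
    perm : concat (cyclesᵗ (Φᵗ t)) ↭ range n
    perm = cyclesᵗ-perm (Φᵗ-treeOf T)

  app-Φ : app (Φ (flat t)) x ≡ app (fromCycles n (cyclesᵗ (Φᵗ t))) x
  app-Φ = cong (λ τ → app τ x)
    (trans (Φ-flat T) (foataInv-perm (decreasing (Φᵗ-treeOf T)) (permutation (Φᵗ-treeOf T))))

  fixed-Φ : (app (Φ (flat t)) x == x) ≡ (x ∈ᵇ rixᵗ t)
  fixed-Φ with x ∈? rixᵗ t
  ... | yes x∈rix = trans
    (trans (cong (_== x) (trans app-Φ (app-next (cyclesᵗ (Φᵗ t)) perm (∈-singletonᶜ⁺ t x∈rix) [] refl))) (==-refl x))
    (sym (∈ᵇ-true x∈rix))
  ... | no x∉rix = trans (==-false (not-fixed ∘ trans (sym app-Φ))) (sym (∈ᵇ-false (rixᵗ t) x∉rix))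
    where
    not-fixed : app (fromCycles n (cyclesᵗ (Φᵗ t))) x ≢ x
    not-fixed fixed with ∈-concat⁻′ (cyclesᵗ (Φᵗ t)) (∈-resp-↭ (↭-sym perm) x∈)
    ... | h ∷ c , x∈c , c∈ = x∉rix (∈-singletonᶜ⁻ t
      (subst (_∈ cyclesᵗ (Φᵗ t)) (app-fixed⇒singleton (cyclesᵗ (Φᵗ t)) perm c∈ x∈c fixed) c∈))

  unmoved : Bool
  unmoved = (x ∈ᵇ rixᵗ t) ∨ (β₁ᵗ t == x)

  -- The two restrictions agree clause by clause: rixed points become fixed points, and `β₁` becomes
  -- the first letter.
  unmoved-Φ : ((app (Φ (flat t)) x == x) ∨ (head (foata (Φ (flat t))) ==ᴹ x)) ≡ unmoved
  unmoved-Φ = cong₂ _∨_ fixed-Φ (cong (_==ᴹ x) (trans (cong head (foata-Φ T)) (head-Φᵗ t)))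

  Φ-hop^-unmoved : unmoved ≡ true → Φ (flat (hop^ᵗ x t)) ≡ cyc-hop^ x (Φ (flat t))
  Φ-hop^-unmoved eq = trans (cong (Φ ∘ flat) (if-true eq)) (sym (if-true (trans unmoved-Φ eq)))

  Φ-hop^ : Φ (flat (hop^ᵗ x t)) ≡ cyc-hop^ x (Φ (flat t))
  Φ-hop^ with x ∈? rixᵗ t | x ≟ β₁ᵗ t
  ... | yes x∈rix | _ = Φ-hop^-unmoved (cong (_∨ (β₁ᵗ t == x)) (∈ᵇ-true x∈rix))
  ... | no _ | yes refl =
    Φ-hop^-unmoved (trans (cong ((x ∈ᵇ rixᵗ t) ∨_) (==-refl x)) (∨-zeroʳ (x ∈ᵇ rixᵗ t)))
  ... | no x∉rix | no x≢β₁ = begin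
    Φ (flat (hop^ᵗ x t))                      ≡⟨ cong (Φ ∘ flat) (if-false moved) ⟩
    Φ (flat (hopᵗ (_== x) t))                 ≡⟨ Φ-flat (hopᵗ-treeOf T (_== x)) ⟩
    foataInv (flat (Φᵗ (hopᵗ (_== x) t)))     ≡⟨ cong (foataInv ∘ flat) (Φᵗ-hopᵗ t x∉rix x≢β₁) ⟩
    foataInv (flat (hopᵗ (_== x) (Φᵗ t)))     ≡⟨ cyc-hop-flat (Φᵗ-treeOf T) x ⟨
    cyc-hop x (foataInv (flat (Φᵗ t)))        ≡⟨ cong (cyc-hop x) (Φ-flat T) ⟨
    cyc-hop x (Φ (flat t))                    ≡⟨ if-false (trans unmoved-Φ moved) ⟨
    cyc-hop^ x (Φ (flat t))                   ∎
    where
    open ≡-Reasoning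
    moved : unmoved ≡ false
    moved = cong₂ _∨_ (∈ᵇ-false (rixᵗ t) x∉rix) (==-false (x≢β₁ ∘ sym))

-- Whether a letter is frozen is tested on the current word, so the products are compared one hop at
-- a time instead of through `χ`. Letters are counted from `suc k`, and `k + m ≤ n` keeps each of
-- them in `range n`, as `Φ-hop^` requires.
Φ-applySubset-hop^ : ∀ {n m} k (S : Subset m) {t} → TreeOf n t → k + m ≤ n →
  Φ (applySubset hop^ (suc k) S (flat t)) ≡ applySubset cyc-hop^ (suc k) S (Φ (flat t))
Φ-applySubset-hop^ k []ᵛ T _ = refl
Φ-applySubset-hop^ {n} {suc m} k (true ∷ᵛ S) {t} T k+m<n = begin
  Φ (applySubset hop^ (2 + k) S (hop^ (suc k) (flat t)))
    ≡⟨ cong (Φ ∘ applySubset hop^ (2 + k) S) (hop^-flat (suc k) t (decreasing T)) ⟩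
  Φ (applySubset hop^ (2 + k) S (flat (hop^ᵗ (suc k) t)))
    ≡⟨ Φ-applySubset-hop^ (suc k) S (hop^ᵗ-treeOf (suc k) T) k<n ⟩
  applySubset cyc-hop^ (2 + k) S (Φ (flat (hop^ᵗ (suc k) t)))
    ≡⟨ cong (applySubset cyc-hop^ (2 + k) S) (Φ-hop^ T (∈-range⁺ (m+n≤o⇒m≤o (suc k) k<n))) ⟩
  applySubset cyc-hop^ (2 + k) S (cyc-hop^ (suc k) (Φ (flat t)))
    ∎
  where
  open ≡-Reasoning
  k<n : suc k + m ≤ n
  k<n = subst (_≤ n) (+-suc k m) k+m<n
Φ-applySubset-hop^ {n} {suc m} k (false ∷ᵛ S) T k+m<n =
  Φ-applySubset-hop^ (suc k) S T (subst (_≤ n) (+-suc k m) k+m<n)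

Φ-VHOrbit^ : ∀ {n t} → TreeOf n t → ImageEq Φ (VHOrbit^ n (flat t)) (CVHOrbit^ n (Φ (flat t)))
Φ-VHOrbit^ T =
  (λ { σ (S , refl) → S , sym (Φ-applySubset-hop^ 0 S T ≤-refl) }) ,
  (λ { τ (S , refl) → _ , (S , refl) , Φ-applySubset-hop^ 0 S T ≤-refl })

theorem25 : (n : ℕ) (π : List ℕ) → IsPerm n π →
    ImageEq Φ (VHOrbit n π) (CVHOrbit n (Φ π))
    × ImageEq Φ (VHOrbit^ n π) (CVHOrbit^ n (Φ π))
theorem25 n π perm with fromWord (suc n) π (unique-resp-↭ (↭-sym perm) (range-unique n)) π≤n
  where
  π≤n : All (_< suc n) π
  π≤n = All.tabulate λ x∈π → bound (∈-range⁻ (∈-resp-↭ perm x∈π))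
    where
    bound : ∀ {x} → (∃ λ k → x ≡ suc k × k < n) → x < suc n
    bound (_ , refl , k<n) = s≤s k<n
... | inj₂ (t , dec , refl) = Φ-VHOrbit (treeOf dec perm) , Φ-VHOrbit^ (treeOf dec perm)
-- Trees are nonempty, so the empty permutation is treated directly.
theorem25 zero π perm | inj₁ refl =
  ((λ { _ ([]ᵛ , refl) → []ᵛ , refl }) , (λ { _ ([]ᵛ , refl) → [] , ([]ᵛ , refl) , refl })) ,
  ((λ { _ ([]ᵛ , refl) → []ᵛ , refl }) , (λ { _ ([]ᵛ , refl) → [] , ([]ᵛ , refl) , refl }))
theorem25 (suc n) π perm | inj₁ refl with ↭-length perm
... | ()
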